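{- Let $\Gamma$ be a distance-regular graph with classical parameters $(D,b,\alpha,\beta)$ such that $b\ge2$, $b-1\ge\alpha\ge1$ and $D\ge3$, geometric with respect to a set $\mathcal C$ of Delsarte cliques. Let $r=[D]$. Assume that for every vertex $x$ the local graph at $x$ is the $\alpha$-clique extension of a $\frac{\beta}{\alpha}\times r$-grid, and assume $\beta>\alpha r$. Then: (a) for every assembly $M$ and every vertex $x$ at distance $i$ from $M$ ($i=0,1,\dots,D$), the number of vertices of $M$ at distance $i$ from $x$ equals $1+\alpha[i]$; (b) for every two vertices $x,y$ at distance $j$ ($j=1,\dots,D$), the number of assemblies containing $y$ at distance $j-1$ from $x$ equals $[j]$; (c) for every two vertices $x,y$ at distance $h$ ($h=0,1,\dots,D-1$), the subgraph induced on $B_h(x,y)=\Gamma_{h+1}(x)\cap\Gamma(y)$ is the $\alpha$-clique extension of a $(\frac{\beta}{\alpha}-[h])\times(r-[h])$-grid.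
   Context: Distance-regular graph with intersection numbers $b_i,c_i$, valency $k=b_0$; $\Gamma_i(x)$ is the set of vertices at distance $i$ from $x$, $\Gamma(y)=\Gamma_1(y)$. For integer $b\ne1$, $[j]=\frac{b^j-1}{b-1}$. Classical parameters $(D,b,\alpha,\beta)$: diameter $D$, $b_i=([D]-[i])(\beta-\alpha[i])$, $c_i=[i](1+\alpha[i-1])$. A Delsarte clique is a clique with $1+\frac{k}{ -\theta_{\min}}$ vertices, $\theta_{\min}$ the smallest adjacency eigenvalue; geometric with respect to $\mathcal C$ means every edge lies in exactly one member of $\mathcal C$. An assembly is a maximal clique of $\Gamma$ not in $\mathcal C$. Distance from a vertex to a set $T$: $d(x,T)=\min_{y\in T}d(x,y)$. The $m\times n$-grid is $K_m\Box K_n$; the $s$-clique extension of $\Delta$ replaces each vertex by an $s$-clique, vertices in distinct cliques being adjacent iff the original vertices are adjacent. -}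

module Defs where

open import Level using (0ℓ)
open import Algebra.Bundles using (CommutativeMonoid)
import Algebra.Properties.CommutativeSemigroup as CommutativeSemigroupProperties
open import Data.Bool.Base using (if_then_else_)
open import Data.Nat.Base as ℕ using (ℕ; zero; suc; _⊔_)
import Data.Nat.Properties as ℕ
open import Data.Integer.Base as ℤ using (ℤ; 0ℤ; 1ℤ)
open import Data.Rational.Base as ℚ using (ℚ; 0ℚ; 1ℚ; ½)
import Data.Rational.Properties as ℚ
open import Data.Rational.Literals using (fromℤ)
open import Data.Fin.Base using (Fin)
open import Data.Fin.Properties using (any?) renaming (_≟_ to _≟ᶠ_)
open import Data.Fin.Subset using (Subset; _∈_; _⊆_; _∩_; ∣_∣)
open import Data.List.Base using (List; length)
import Data.List.Membership.Propositional as List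
open import Data.List.Relation.Unary.Unique.Propositional using (Unique)
open import Data.Product using (∃!; ∃-syntax; Σ-syntax; _×_; _,_; proj₁; proj₂)
open import Data.Sum.Base as Sum using (_⊎_; inj₁; inj₂)
open import Data.Vec.Base using (tabulate)
import Data.Vec.Functional as Vector
open import Function.Base using (_∘_)
open import Function.Bundles using (_⇔_; _↔_; Inverse)
open import Relation.Binary.Core using (Rel)
open import Relation.Binary.Definitions using (Decidable; Symmetric; Irreflexive)
open import Relation.Binary.PropositionalEquality
  using (_≡_; _≢_; refl; sym; trans; cong; cong₂; subst)
open import Relation.Nullary using (¬_; Dec; does; ¬?; _×-dec_)
open import Relation.Unary using (Pred) renaming (_∈_ to _∈ᴾ_)

fromℕ : ℕ → ℚ
fromℕ n = fromℤ (ℤ.+ n)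

-- Reals are represented by Cauchy sequences of rationals, compared by _≈ᴿ_.

IsCauchy : Pred (ℕ → ℚ) 0ℓ
IsCauchy s = ∀ {ε} → 0ℚ ℚ.< ε →
  ∃[ N ] (∀ {i j} → N ℕ.≤ i → N ℕ.≤ j → ℚ.∣ s i ℚ.- s j ∣ ℚ.< ε)

private
  open CommutativeSemigroupProperties
    (CommutativeMonoid.commutativeSemigroup ℚ.+-0-commutativeMonoid) using (interchange)

  ½-pos : ∀ {ε} → 0ℚ ℚ.< ε → 0ℚ ℚ.< ½ ℚ.* ε
  ½-pos {ε} 0<ε = subst (ℚ._< ½ ℚ.* ε) (ℚ.*-zeroʳ ½) (ℚ.*-monoʳ-<-pos ½ 0<ε)

  halves : ∀ ε → ½ ℚ.* ε ℚ.+ ½ ℚ.* ε ≡ ε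
  halves ε = trans (sym (ℚ.*-distribʳ-+ ε ½ ½)) (ℚ.*-identityˡ ε)

  sub-add : ∀ p q → (p ℚ.- q) ℚ.+ q ≡ p
  sub-add p q = trans (ℚ.+-assoc p (ℚ.- q) q)
    (trans (cong (p ℚ.+_) (ℚ.+-inverseˡ q)) (ℚ.+-identityʳ p))

  *-distribˡ-- : ∀ p q r → p ℚ.* (q ℚ.- r) ≡ p ℚ.* q ℚ.- p ℚ.* r
  *-distribˡ-- p q r = trans (ℚ.*-distribˡ-+ p q (ℚ.- r))
    (cong (p ℚ.* q ℚ.+_) (sym (ℚ.neg-distribʳ-* p r)))

  bounded : ∀ s → IsCauchy s →
    ∃[ B ] ∃[ N ] (0ℚ ℚ.< B × (∀ {i} → N ℕ.≤ i → ℚ.∣ s i ∣ ℚ.< B))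
  bounded s cs with cs (ℚ.positive⁻¹ 1ℚ)
  ... | N , close = 1ℚ ℚ.+ ℚ.∣ s N ∣ , N ,
        ℚ.+-mono-<-≤ (ℚ.positive⁻¹ 1ℚ) (ℚ.0≤∣p∣ (s N)) , λ {i} N≤i → begin-strict
          ℚ.∣ s i ∣                         ≡⟨ cong ℚ.∣_∣ (sym (sub-add (s i) (s N))) ⟩
          ℚ.∣ (s i ℚ.- s N) ℚ.+ s N ∣       ≤⟨ ℚ.∣p+q∣≤∣p∣+∣q∣ (s i ℚ.- s N) (s N) ⟩
          ℚ.∣ s i ℚ.- s N ∣ ℚ.+ ℚ.∣ s N ∣   <⟨ ℚ.+-monoˡ-< ℚ.∣ s N ∣ (close N≤i ℕ.≤-refl) ⟩
          1ℚ ℚ.+ ℚ.∣ s N ∣                  ∎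
    where
    open ℚ.≤-Reasoning

  const-cauchy : ∀ q → IsCauchy (λ _ → q)
  const-cauchy q {ε} 0<ε = 0 , λ _ _ →
    subst (λ d → ℚ.∣ d ∣ ℚ.< ε) (sym (ℚ.+-inverseʳ q)) 0<ε

  neg-cauchy : ∀ s → IsCauchy s → IsCauchy (ℚ.-_ ∘ s)
  neg-cauchy s cs {ε} 0<ε with cs 0<ε
  ... | N , close = N , λ {i} {j} N≤i N≤j → subst (ℚ._< ε)
        (trans (sym (ℚ.∣-p∣≡∣p∣ (s i ℚ.- s j))) (cong ℚ.∣_∣ (ℚ.neg-distrib-+ (s i) (ℚ.- s j))))
        (close N≤i N≤j)

  +-cauchy : ∀ s t → IsCauchy s → IsCauchy t → IsCauchy (λ i → s i ℚ.+ t i)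
  +-cauchy s t cs ct {ε} 0<ε with cs (½-pos 0<ε) | ct (½-pos 0<ε)
  ... | M , close-s | N , close-t = M ⊔ N , λ {i} {j} p q → begin-strict
          ℚ.∣ (s i ℚ.+ t i) ℚ.- (s j ℚ.+ t j) ∣
            ≡⟨ cong ℚ.∣_∣ (regroup (s i) (t i) (s j) (t j)) ⟩
          ℚ.∣ (s i ℚ.- s j) ℚ.+ (t i ℚ.- t j) ∣
            ≤⟨ ℚ.∣p+q∣≤∣p∣+∣q∣ (s i ℚ.- s j) (t i ℚ.- t j) ⟩
          ℚ.∣ s i ℚ.- s j ∣ ℚ.+ ℚ.∣ t i ℚ.- t j ∣
            <⟨ ℚ.+-mono-< (close-s (ℕ.m⊔n≤o⇒m≤o M N p) (ℕ.m⊔n≤o⇒m≤o M N q))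
                          (close-t (ℕ.m⊔n≤o⇒n≤o M N p) (ℕ.m⊔n≤o⇒n≤o M N q)) ⟩
          ½ ℚ.* ε ℚ.+ ½ ℚ.* ε
            ≡⟨ halves ε ⟩
          ε ∎
    where
    open ℚ.≤-Reasoning
    regroup : ∀ a b c d → (a ℚ.+ b) ℚ.- (c ℚ.+ d) ≡ (a ℚ.- c) ℚ.+ (b ℚ.- d)
    regroup a b c d = trans (cong (a ℚ.+ b ℚ.+_) (ℚ.neg-distrib-+ c d))
      (interchange a b (ℚ.- c) (ℚ.- d))

  *-cauchy : ∀ s t → IsCauchy s → IsCauchy t → IsCauchy (λ i → s i ℚ.* t i)
  *-cauchy s t cs ct {ε} 0<ε with bounded s cs | bounded t ct
  ... | B , K , 0<B , s<B | C , L , 0<C , t<C =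
        (K ⊔ L) ⊔ (proj₁ close-s ⊔ proj₁ close-t) , λ {i} {j} p q →
        let M = proj₁ close-s ; N = proj₁ close-t
            i≥K = ℕ.m⊔n≤o⇒m≤o K L (ℕ.m⊔n≤o⇒m≤o (K ⊔ L) (M ⊔ N) p)
            j≥L = ℕ.m⊔n≤o⇒n≤o K L (ℕ.m⊔n≤o⇒m≤o (K ⊔ L) (M ⊔ N) q)
            i≥M = ℕ.m⊔n≤o⇒n≤o (K ⊔ L) (M ⊔ N) p
            j≥M = ℕ.m⊔n≤o⇒n≤o (K ⊔ L) (M ⊔ N) q
        in begin-strict
          ℚ.∣ s i ℚ.* t i ℚ.- s j ℚ.* t j ∣
            ≡⟨ cong ℚ.∣_∣ (regroup (s i) (t i) (s j) (t j)) ⟩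
          ℚ.∣ s i ℚ.* (t i ℚ.- t j) ℚ.+ t j ℚ.* (s i ℚ.- s j) ∣
            ≤⟨ ℚ.∣p+q∣≤∣p∣+∣q∣ (s i ℚ.* (t i ℚ.- t j)) (t j ℚ.* (s i ℚ.- s j)) ⟩
          ℚ.∣ s i ℚ.* (t i ℚ.- t j) ∣ ℚ.+ ℚ.∣ t j ℚ.* (s i ℚ.- s j) ∣
            <⟨ ℚ.+-mono-<
                 (small 0<B (s i) (t i ℚ.- t j) (s<B i≥K)
                   (proj₂ close-t (ℕ.m⊔n≤o⇒n≤o M N i≥M) (ℕ.m⊔n≤o⇒n≤o M N j≥M)))
                 (small 0<C (t j) (s i ℚ.- s j) (t<C j≥L)
                   (proj₂ close-s (ℕ.m⊔n≤o⇒m≤o M N i≥M) (ℕ.m⊔n≤o⇒m≤o M N j≥M))) ⟩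
          ½ ℚ.* ε ℚ.+ ½ ℚ.* ε
            ≡⟨ halves ε ⟩
          ε ∎
    where
    open ℚ.≤-Reasoning

    -- ε / (2A)
    share : ∀ {A} → 0ℚ ℚ.< A → ℚ
    share {A} 0<A = (½ ℚ.* ε ℚ.÷ A) {{ℚ.>-nonZero 0<A}}

    share-pos : ∀ {A} (0<A : 0ℚ ℚ.< A) → 0ℚ ℚ.< share 0<A
    share-pos {A} 0<A = subst (ℚ._< share 0<A) (ℚ.*-zeroˡ ((ℚ.1/ A) {{ℚ.>-nonZero 0<A}}))
      (ℚ.*-monoˡ-<-pos _ {{ℚ.1/pos⇒pos A {{ℚ.positive 0<A}}}} (½-pos 0<ε))

    A*share : ∀ {A} (0<A : 0ℚ ℚ.< A) → A ℚ.* share 0<A ≡ ½ ℚ.* ε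
    A*share {A} 0<A = trans (ℚ.*-comm A _) (trans (ℚ.*-assoc (½ ℚ.* ε) _ A)
      (trans (cong (½ ℚ.* ε ℚ.*_) (ℚ.*-inverseˡ A {{ℚ.>-nonZero 0<A}})) (ℚ.*-identityʳ _)))

    small : ∀ {A} (0<A : 0ℚ ℚ.< A) u d → ℚ.∣ u ∣ ℚ.< A → ℚ.∣ d ∣ ℚ.< share 0<A →
            ℚ.∣ u ℚ.* d ∣ ℚ.< ½ ℚ.* ε
    small {A} 0<A u d u<A d<δ = begin-strict
      ℚ.∣ u ℚ.* d ∣          ≡⟨ ℚ.∣p*q∣≡∣p∣*∣q∣ u d ⟩
      ℚ.∣ u ∣ ℚ.* ℚ.∣ d ∣    ≤⟨ ℚ.*-monoʳ-≤-nonNeg ℚ.∣ d ∣ {{ℚ.∣-∣-nonNeg d}} (ℚ.<⇒≤ u<A) ⟩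
      A ℚ.* ℚ.∣ d ∣          <⟨ ℚ.*-monoʳ-<-pos A {{ℚ.positive 0<A}} d<δ ⟩
      A ℚ.* share 0<A        ≡⟨ A*share 0<A ⟩
      ½ ℚ.* ε                ∎

    close-s : ∃[ M ] (∀ {i j} → M ℕ.≤ i → M ℕ.≤ j → ℚ.∣ s i ℚ.- s j ∣ ℚ.< share 0<C)
    close-s = cs (share-pos 0<C)

    close-t : ∃[ N ] (∀ {i j} → N ℕ.≤ i → N ℕ.≤ j → ℚ.∣ t i ℚ.- t j ∣ ℚ.< share 0<B)
    close-t = ct (share-pos 0<B)

    regroup : ∀ a b c d → a ℚ.* b ℚ.- c ℚ.* d ≡ a ℚ.* (b ℚ.- d) ℚ.+ d ℚ.* (a ℚ.- c)
    regroup a b c d = sym (begin-equality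
      a ℚ.* (b ℚ.- d) ℚ.+ d ℚ.* (a ℚ.- c)
        ≡⟨ cong₂ ℚ._+_ (*-distribˡ-- a b d) (trans (*-distribˡ-- d a c)
             (cong₂ ℚ._-_ (ℚ.*-comm d a) (ℚ.*-comm d c))) ⟩
      (a ℚ.* b ℚ.- a ℚ.* d) ℚ.+ (a ℚ.* d ℚ.- c ℚ.* d)
        ≡⟨ ℚ.+-assoc (a ℚ.* b ℚ.- a ℚ.* d) (a ℚ.* d) (ℚ.- (c ℚ.* d)) ⟨
      (a ℚ.* b ℚ.- a ℚ.* d) ℚ.+ a ℚ.* d ℚ.- c ℚ.* d
        ≡⟨ cong (ℚ._- c ℚ.* d) (sub-add (a ℚ.* b) (a ℚ.* d)) ⟩
      a ℚ.* b ℚ.- c ℚ.* d ∎)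

record ℝ : Set where
  constructor mkℝ
  field
    seq    : ℕ → ℚ
    cauchy : IsCauchy seq

open ℝ public

infix  4 _≈ᴿ_ _≤ᴿ_
infixl 6 _+ᴿ_
infixl 7 _*ᴿ_
infix  8 -ᴿ_

_≈ᴿ_ : Rel ℝ 0ℓ
x ≈ᴿ y = ∀ {ε} → 0ℚ ℚ.< ε → ∃[ N ] (∀ {i} → N ℕ.≤ i → ℚ.∣ seq x i ℚ.- seq y i ∣ ℚ.< ε)

_≤ᴿ_ : Rel ℝ 0ℓ
x ≤ᴿ y = ∀ {ε} → 0ℚ ℚ.< ε → ∃[ N ] (∀ {i} → N ℕ.≤ i → seq x i ℚ.< seq y i ℚ.+ ε)

fromℚ : ℚ → ℝ
fromℚ q = mkℝ (λ _ → q) (const-cauchy q)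

0ᴿ 1ᴿ : ℝ
0ᴿ = fromℚ 0ℚ
1ᴿ = fromℚ 1ℚ

_+ᴿ_ _*ᴿ_ : ℝ → ℝ → ℝ
x +ᴿ y = mkℝ (λ i → seq x i ℚ.+ seq y i) (+-cauchy (seq x) (seq y) (cauchy x) (cauchy y))
x *ᴿ y = mkℝ (λ i → seq x i ℚ.* seq y i) (*-cauchy (seq x) (seq y) (cauchy x) (cauchy y))

-ᴿ_ : ℝ → ℝ
-ᴿ x = mkℝ (λ i → ℚ.- seq x i) (neg-cauchy (seq x) (cauchy x))

∑ : ∀ {n} → (Fin n → ℝ) → ℝ
∑ = Vector.foldr _+ᴿ_ 0ᴿ

record Graph (V : Set) : Set₁ where
  infix 4 _~_
  field
    _~_      : Rel V 0ℓ
    ~-sym    : Symmetric _~_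
    ~-irrefl : Irreflexive _≡_ _~_

record _≅_ {V W : Set} (G : Graph V) (H : Graph W) : Set where
  private
    module G = Graph G
    module H = Graph H
  field
    vertices : V ↔ W
  open Inverse vertices public using (to)
  field
    adjacent : ∀ u v → u G.~ v ⇔ to u H.~ to v

K : (n : ℕ) → Graph (Fin n)
K n = record { _~_ = _≢_ ; ~-sym = λ p → p ∘ sym ; ~-irrefl = λ p q → q p }

infixl 6 _□_

_□_ : ∀ {V W} → Graph V → Graph W → Graph (V × W)
G □ H = record
  { _~_      = λ (u , w) (u′ , w′) → (u ≡ u′ × w H.~ w′) ⊎ (u G.~ u′ × w ≡ w′)
  ; ~-sym    = Sum.map (λ (p , q) → sym p , H.~-sym q) (λ (p , q) → G.~-sym p , sym q)
  ; ~-irrefl = λ { refl (inj₁ (_ , q)) → H.~-irrefl refl q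
                 ; refl (inj₂ (p , _)) → G.~-irrefl refl p }
  }
  where
  module G = Graph G
  module H = Graph H

grid : (m n : ℕ) → Graph (Fin m × Fin n)
grid m n = K m □ K n

cliqueExtension : ∀ {V} (s : ℕ) → Graph V → Graph (V × Fin s)
cliqueExtension s G = record
  { _~_      = λ (u , i) (v , j) → u ~ v ⊎ (u ≡ v × i ≢ j)
  ; ~-sym    = Sum.map ~-sym (λ (p , q) → sym p , q ∘ sym)
  ; ~-irrefl = λ { refl (inj₁ p) → ~-irrefl refl p ; refl (inj₂ (_ , q)) → q refl }
  }
  where open Graph G

-- The parameters are given as rationals; part of the assertion is that they
-- are natural numbers.
IsCliqueExtensionOfGrid : ∀ {V} → Graph V → (s p q : ℚ) → Set
IsCliqueExtensionOfGrid G s p q =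
  ∃[ s′ ] ∃[ p′ ] ∃[ q′ ]
    (s ≡ fromℕ s′ × p ≡ fromℕ p′ × q ≡ fromℕ q′ × G ≅ cliqueExtension s′ (grid p′ q′))

record FiniteGraph (n : ℕ) : Set₁ where
  field
    graph : Graph (Fin n)
  open Graph graph public
  field
    _~?_ : Decidable _~_

module _ {n : ℕ} (Γ : FiniteGraph n) where
  open FiniteGraph Γ

  induced : (S : Subset n) → Graph (Σ[ v ∈ Fin n ] v ∈ S)
  induced S = record
    { _~_      = λ (u , _) (v , _) → u ~ v
    ; ~-sym    = ~-sym
    ; ~-irrefl = λ { refl → ~-irrefl refl }
    }

  Walk : ℕ → Rel (Fin n) 0ℓ
  Walk zero    x y = x ≡ y
  Walk (suc l) x y = ∃[ z ] (x ~ z × Walk l z y)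

  walk? : ∀ l → Decidable (Walk l)
  walk? zero    x y = x ≟ᶠ y
  walk? (suc l) x y = any? λ z → (x ~? z) ×-dec walk? l z y

  Distance : Fin n → Fin n → ℕ → Set
  Distance x y i = Walk i x y × (∀ {l} → l ℕ.< i → ¬ Walk l x y)

  distance? : ∀ x y i → Dec (Distance x y i)
  distance? x y i = walk? i x y ×-dec ℕ.allUpTo? (λ l → ¬? (walk? l x y)) i

  Sphere : ℕ → Fin n → Subset n
  Sphere i x = tabulate λ y → does (distance? x y i)

  DistanceToSet : Fin n → Subset n → ℕ → Set
  DistanceToSet x T i =
    (∃[ y ] (y ∈ T × Distance x y i)) × (∀ {y j} → y ∈ T → Distance x y j → i ℕ.≤ j)

  Connected : Set
  Connected = ∀ x y → ∃[ l ] Walk l x y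

  HasDiameter : ℕ → Set
  HasDiameter D =
    (∀ {x y i} → Distance x y i → i ℕ.≤ D) × (∃[ x ] ∃[ y ] Distance x y D)

  -- The value c 0 is unconstrained.
  record IsDistanceRegular (b c : ℕ → ℕ) : Set where
    field
      connected : Connected
      b-count   : ∀ {x y i} → Distance x y i → ∣ Sphere (suc i) x ∩ Sphere 1 y ∣ ≡ b i
      c-count   : ∀ {x y i} → Distance x y (suc i) →
                  ∣ Sphere i x ∩ Sphere 1 y ∣ ≡ c (suc i)

  A : Fin n → Fin n → ℝ
  A x y = if does (x ~? y) then 1ᴿ else 0ᴿ

  IsEigenvalue : ℝ → Set
  IsEigenvalue θ = Σ[ v ∈ (Fin n → ℝ) ]
    ((¬ (∀ x → v x ≈ᴿ 0ᴿ)) × (∀ x → ∑ (λ y → A x y *ᴿ v y) ≈ᴿ θ *ᴿ v x))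

  IsSmallestEigenvalue : ℝ → Set
  IsSmallestEigenvalue θ = IsEigenvalue θ × (∀ μ → IsEigenvalue μ → θ ≤ᴿ μ)

  IsClique : Subset n → Set
  IsClique C = ∀ {x y} → x ∈ C → y ∈ C → x ≢ y → x ~ y

  IsMaximalClique : Subset n → Set
  IsMaximalClique C = IsClique C × (∀ {C′} → IsClique C′ → C ⊆ C′ → C′ ≡ C)

  -- |C| = 1 + k / (-θ), with the denominator cleared.  For k ≠ 0 the equation
  -- forces θ ≠ 0.
  IsDelsarteClique : (k : ℕ) → Subset n → Set
  IsDelsarteClique k C = IsClique C × Σ[ θ ∈ ℝ ]
    (IsSmallestEigenvalue θ ×
     fromℚ (fromℕ ∣ C ∣ ℚ.- 1ℚ) *ᴿ (-ᴿ θ) ≈ᴿ fromℚ (fromℕ k))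

  IsGeometric : (k : ℕ) → Pred (Subset n) 0ℓ → Set
  IsGeometric k 𝒞 =
    (∀ {C} → C ∈ᴾ 𝒞 → IsDelsarteClique k C) ×
    (∀ {x y} → x ~ y → ∃! _≡_ λ C → C ∈ᴾ 𝒞 × x ∈ C × y ∈ C)

  IsAssembly : Pred (Subset n) 0ℓ → Pred (Subset n) 0ℓ
  IsAssembly 𝒞 M = IsMaximalClique M × ¬ (M ∈ᴾ 𝒞)

-- (b ^ j - 1) / (b - 1)
[_,_] : (b : ℤ) → ℕ → .{{_ : ℤ.NonZero (b ℤ.- 1ℤ)}} → ℚ
[ b , j ] = fromℤ (b ℤ.^ j ℤ.- 1ℤ) ℚ.÷ fromℤ (b ℤ.- 1ℤ)

record HasClassicalParameters {n : ℕ} (Γ : FiniteGraph n)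
         (D : ℕ) (b : ℤ) .{{_ : ℤ.NonZero (b ℤ.- 1ℤ)}} (α β : ℚ) : Set where
  field
    intersection-b intersection-c : ℕ → ℕ
    distance-regular : IsDistanceRegular Γ intersection-b intersection-c
    diameter         : HasDiameter Γ D
    b-formula : ∀ {i} → i ℕ.≤ D →
      fromℕ (intersection-b i) ≡ ([ b , D ] ℚ.- [ b , i ]) ℚ.* (β ℚ.- α ℚ.* [ b , i ])
    c-formula : ∀ {i} → suc i ℕ.≤ D →
      fromℕ (intersection-c (suc i)) ≡ [ b , suc i ] ℚ.* (1ℚ ℚ.+ α ℚ.* [ b , i ])

  valency : ℕ
  valency = intersection-b 0

HasCount : ∀ {A : Set} → Pred A 0ℓ → ℚ → Set
HasCount {A} P q =
  Σ[ xs ∈ List A ] (Unique xs × (∀ x → x List.∈ xs ⇔ P x) × fromℕ (length xs) ≡ q)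

{-# OPTIONS --safe #-}
module Submission where

-- With p = β / α and a = α, the local grids turn the maximal cliques through a vertex into r long
-- lines (a p + 1 points) and p short lines (a r + 1 points).  Summing the squared line sums of a
-- vector over all flags (vertex, long line) shows that A + r I is positive semidefinite, so Delsarte
-- cliques have at least a p + 1 vertices: 𝒞 contains every long line and the assemblies are exactly
-- the short lines.
--
-- The counts follow by induction on the distance h, simultaneously for both kinds of lines.  If every
-- line at distance h - 1 from x has 1 + a [h - 1] points at that distance, then c_h forces exactly [h]
-- lines of each kind through a vertex y at distance h to come nearer to x.  Then
-- b_h = a (p - [h]) (r - [h]) forces all neighbours of y off these near lines to be at distance h + 1,
-- so a line through y at distance h from x meets distance h in y and in one a-clique for each of the
-- [h] near lines of the other kind.

open import Defs
open import Level using (0ℓ)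
open import Algebra.Bundles using (CommutativeRing)
import Algebra.Properties.Semiring.Sum as SemiringSum
open import Data.Bool.Base using (true; false; if_then_else_)
open import Data.Fin.Base using (Fin; zero; suc; fromℕ<)
open import Data.Fin.Properties using (any?; suc-injective) renaming (_≟_ to _≟ᶠ_)
open import Data.Fin.Subset using (Subset; _∈_; _⊆_; _∩_; ∣_∣)
open import Data.Fin.Subset.Properties
  using (_∈?_; ⊆-antisym; p⊆q⇒∣p∣≤∣q∣; p⊂q⇒∣p∣<∣q∣; x∈p∩q⁺; x∈p∩q⁻)
open import Data.Integer.Base as ℤ using (ℤ; 1ℤ)
import Data.Integer.Properties as ℤ
import Data.Integer.Solver as ℤSolver
open import Data.List.Base as List using (List; _∷_; filter; length; allFin)
import Data.List.Membership.Propositional as List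
open import Data.List.Membership.Propositional.Properties
  using (∈-map⁺; ∈-map⁻; ∈-filter⁺; ∈-filter⁻; ∈-allFin; ∈-lookup)
open import Data.List.Properties using (length-map)
import Data.List.Relation.Unary.All as All
open import Data.List.Relation.Unary.AllPairs using (_∷_)
import Data.List.Relation.Unary.Any as Any
open import Data.List.Relation.Unary.Any.Properties using (lookup-index)
open import Data.List.Relation.Unary.Unique.Propositional using (Unique)
open import Data.List.Relation.Unary.Unique.Propositional.Properties using (map⁺; filter⁺; allFin⁺)
open import Data.Nat.Base as ℕ using (ℕ; zero; suc; _∸_; _⊔_)
open import Data.Nat.Induction using (<-wellFounded)
import Data.Nat.Properties as ℕ
open import Data.Product using (_×_; _,_; proj₁; proj₂; ∃-syntax; Σ-syntax)
open import Data.Rational.Base as ℚ using (ℚ; 0ℚ; 1ℚ; ½; _+_; _-_; _*_; _÷_)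
open import Data.Rational.Literals using (fromℤ)
import Data.Rational.Properties as ℚ
import Data.Rational.Solver as ℚSolver
import Data.Rational.Unnormalised.Base as ℚᵘ
import Data.Rational.Unnormalised.Properties as ℚᵘ
open import Data.Sum.Base as Sum using (_⊎_; inj₁; inj₂)
open import Data.Vec.Base using (tabulate; []; _∷_; here; there)
open import Data.Vec.Properties using ([]=⇒lookup; lookup⇒[]=; lookup∘tabulate)
open import Data.Vec.Properties.WithK using ([]=-irrelevant)
open import Function.Base using (_∘_; case_of_)
open import Function.Bundles using (_⇔_; _↔_; mk⇔; mk⤖; Equivalence; Inverse)
open import Function.Construct.Composition using (_⇔-∘_)
open import Function.Properties.Bijection using (⤖⇒↔)
open import Function.Properties.Inverse using (↔-sym)
open import Induction.WellFounded using (Acc; acc)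
open import Relation.Binary.PropositionalEquality hiding ([_])
open import Relation.Nullary
  using (Dec; yes; no; does; ¬_; ¬?; contradiction; _×-dec_; _⊎-dec_)
open import Relation.Nullary.Decidable using (dec-true; dec-false; does-⇔; decidable-stable)
open import Relation.Unary using (Pred) renaming (_∈_ to _∈ᴾ_)

-- Size alone tells which lines can belong to `𝒞`: since k = r p a, the bound -θ ≤ r gives 1 + k /
-- (-θ) ≥ p a + 1, more than the r a + 1 points of a short line because β > α r. The constant r in A
-- + r I is the number of long lines through a vertex: if N is the incidence matrix of vertices and
-- long lines, then N Nᵀ = A + r I. The obstacle is that θ and its eigenvector are Cauchy sequences,
-- whose signs and zeros cannot be decided. So θ is eliminated between the eigenvector equation and
-- the clique equation before any inequality is used, the quadratic form is evaluated only on the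
-- rational terms of the eigenvector, and a Delsarte clique with fewer than p a + 1 vertices is
-- refuted because it would make the eigenvector zero. Both kinds of lines have to be treated in one
-- induction because the points at distance h on a line of one kind are cut out by the near lines of
-- the other kind.

module ℕΣ = SemiringSum ℕ.+-*-semiring
module ℚΣ = SemiringSum (CommutativeRing.semiring ℚ.+-*-commutativeRing)

open ℕΣ using (sum; sum-syntax; sum-cong-≗; sum-replicate-zero; ∑-comm; ∑-distrib-+
              ; *-distribˡ-sum; *-distribʳ-sum)

-- Finite sums and counting

ind : {P : Set} → Dec P → ℕ
ind d = if does d then 1 else 0

ind-true : {P : Set} (d : Dec P) → P → ind d ≡ 1
ind-true d p = cong (if_then 1 else 0) (dec-true d p)

ind-false : {P : Set} (d : Dec P) → ¬ P → ind d ≡ 0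
ind-false d ¬p = cong (if_then 1 else 0) (dec-false d ¬p)

ind-cong : {P Q : Set} (d : Dec P) (e : Dec Q) → P ⇔ Q → ind d ≡ ind e
ind-cong d e P⇔Q = cong (if_then 1 else 0) (does-⇔ P⇔Q d e)

ind-≤ : {P : Set} (d : Dec P) {m : ℕ} → (P → 1 ℕ.≤ m) → ind d ℕ.≤ m
ind-≤ (yes p) 1≤m = 1≤m p
ind-≤ (no _)  1≤m = ℕ.z≤n

ind-× : {P Q : Set} (d : Dec P) (e : Dec Q) → ind (d ×-dec e) ≡ ind d ℕ.* ind e
ind-× (yes _) (yes _) = refl
ind-× (yes _) (no _)  = refl
ind-× (no _)  _       = refl

∑-zero : ∀ m {f : Fin m → ℕ} → (∀ i → f i ≡ 0) → sum f ≡ 0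
∑-zero m f≡0 = trans (sum-cong-≗ f≡0) (sum-replicate-zero m)

∑-const : ∀ m {f : Fin m → ℕ} c → (∀ i → f i ≡ c) → sum f ≡ m ℕ.* c
∑-const zero    c f≡c = refl
∑-const (suc m) c f≡c = cong₂ ℕ._+_ (f≡c zero) (∑-const m c (f≡c ∘ suc))

∑-single : ∀ {m} (f : Fin m → ℕ) i → (∀ j → j ≢ i → f j ≡ 0) → sum f ≡ f i
∑-single f zero    off = trans (cong (f zero ℕ.+_) (∑-zero _ λ j → off (suc j) λ ())) (ℕ.+-identityʳ _)
∑-single f (suc i) off = cong₂ ℕ._+_ (off zero λ ())
  (∑-single (f ∘ suc) i λ j j≢i → off (suc j) (j≢i ∘ suc-injective))

∑-mono-≤ : ∀ {m} {f g : Fin m → ℕ} → (∀ i → f i ℕ.≤ g i) → sum f ℕ.≤ sum g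
∑-mono-≤ {zero}  f≤g = ℕ.z≤n
∑-mono-≤ {suc m} f≤g = ℕ.+-mono-≤ (f≤g zero) (∑-mono-≤ (f≤g ∘ suc))

-- A deficit in one term could not be made up by the others. This is how the exact value of an
-- intersection number fixes the distance of each single neighbour.
∑-tight : ∀ {m} {f g : Fin m → ℕ} → (∀ i → f i ℕ.≤ g i) → sum g ℕ.≤ sum f → ∀ i → f i ≡ g i
∑-tight {suc m} {f} {g} f≤g ∑g≤∑f zero = ℕ.≤-antisym (f≤g zero)
  (ℕ.+-cancelʳ-≤ (sum (g ∘ suc)) (g zero) (f zero)
    (ℕ.≤-trans ∑g≤∑f (ℕ.+-monoʳ-≤ (f zero) (∑-mono-≤ (f≤g ∘ suc)))))
∑-tight {suc m} {f} {g} f≤g ∑g≤∑f (suc i) = ∑-tight (f≤g ∘ suc)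
  (ℕ.+-cancelˡ-≤ (g zero) _ _ (ℕ.≤-trans ∑g≤∑f (ℕ.+-monoˡ-≤ _ (f≤g zero)))) i

∑-ind-¬ : ∀ {m} {P : Fin m → Set} (P? : ∀ i → Dec (P i)) →
  ∑[ i < m ] ind (¬? (P? i)) ≡ m ∸ ∑[ i < m ] ind (P? i)
∑-ind-¬ {m} P? = begin
  ∑[ i < m ] ind (¬? (P? i))
    ≡⟨ ℕ.m+n∸n≡m _ (∑[ i < m ] ind (P? i)) ⟨
  ∑[ i < m ] ind (¬? (P? i)) ℕ.+ ∑[ i < m ] ind (P? i) ∸ ∑[ i < m ] ind (P? i)
    ≡⟨ cong (_∸ ∑[ i < m ] ind (P? i)) (∑-distrib-+ (λ i → ind (¬? (P? i))) (λ i → ind (P? i))) ⟨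
  ∑[ i < m ] (ind (¬? (P? i)) ℕ.+ ind (P? i)) ∸ ∑[ i < m ] ind (P? i)
    ≡⟨ cong (_∸ ∑[ i < m ] ind (P? i)) (trans (∑-const m 1 (complementary ∘ P?)) (ℕ.*-identityʳ m)) ⟩
  m ∸ ∑[ i < m ] ind (P? i) ∎
  where
  open ≡-Reasoning
  complementary : {P : Set} (d : Dec P) → ind (¬? d) ℕ.+ ind d ≡ 1
  complementary (yes _) = refl
  complementary (no _)  = refl

∑-δ : ∀ {n} (y : Fin n) (f : Fin n → ℕ) → ∑[ z < n ] (ind (y ≟ᶠ z) ℕ.* f z) ≡ f y
∑-δ y f = trans
  (∑-single _ y λ z z≢y → cong (ℕ._* f z) (ind-false (y ≟ᶠ z) (z≢y ∘ sym)))
  (trans (cong (ℕ._* f y) (ind-true (y ≟ᶠ y) refl)) (ℕ.*-identityˡ (f y)))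

∈-tabulate : ∀ {n} {P : Fin n → Set} (P? : ∀ z → Dec (P z)) {z} →
  z ∈ tabulate (does ∘ P?) ⇔ P z
∈-tabulate {P = P} P? {z} = mk⇔
  (λ z∈ → to′ (P? z) (trans (sym (lookup∘tabulate (does ∘ P?) z)) ([]=⇒lookup z∈)))
  (λ Pz → lookup⇒[]= z _ (trans (lookup∘tabulate (does ∘ P?) z) (dec-true (P? z) Pz)))
  where
  to′ : (d : Dec (P z)) → does d ≡ true → P z
  to′ (yes p) _ = p

∣∣≡∑ : ∀ {n} (S : Subset n) → ∣ S ∣ ≡ ∑[ z < n ] ind (z ∈? S)
∣∣≡∑ []          = refl
∣∣≡∑ (true ∷ S)  = cong suc (∣∣≡∑ S)
∣∣≡∑ (false ∷ S) = ∣∣≡∑ S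

∣∩∣≡∑ : ∀ {n} (S T : Subset n) → ∣ S ∩ T ∣ ≡ ∑[ z < n ] (ind (z ∈? S) ℕ.* ind (z ∈? T))
∣∩∣≡∑ S T = trans (∣∣≡∑ (S ∩ T)) (sum-cong-≗ λ z →
  trans (ind-cong (z ∈? S ∩ T) ((z ∈? S) ×-dec (z ∈? T)) (mk⇔ (x∈p∩q⁻ S T) x∈p∩q⁺))
        (ind-× (z ∈? S) (z ∈? T)))

⊆∧∣∣≤⇒≡ : ∀ {n} {S T : Subset n} → S ⊆ T → ∣ T ∣ ℕ.≤ ∣ S ∣ → S ≡ T
⊆∧∣∣≤⇒≡ {S = S} {T} S⊆T ∣T∣≤∣S∣ = ⊆-antisym S⊆T λ {x} x∈T → decidable-stable (x ∈? S) λ x∉S →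
  ℕ.<⇒≱ (p⊂q⇒∣p∣<∣q∣ (S⊆T , x , x∈T , x∉S)) ∣T∣≤∣S∣

-- Lines of the local grids

-- nb y i j k is the k-th neighbour of y in the cell (i , j) of the p × r grid.
record LocalGrid {n : ℕ} (Γ : FiniteGraph n) (a p r : ℕ) : Set where
  open FiniteGraph Γ
  field
    nb        : Fin n → Fin p → Fin r → Fin a → Fin n
    nb-adj    : ∀ y i j k → y ~ nb y i j k
    nb-sur    : ∀ {y z} → y ~ z → ∃[ i ] ∃[ j ] ∃[ k ] nb y i j k ≡ z
    nb-inj    : ∀ {y i j k i′ j′ k′} → nb y i j k ≡ nb y i′ j′ k′ → i ≡ i′ × j ≡ j′ × k ≡ k′
    nb-line   : ∀ {y i j k i′ j′ k′} → nb y i j k ~ nb y i′ j′ k′ → i ≡ i′ ⊎ j ≡ j′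
    nb-row    : ∀ y i {j k j′ k′} → nb y i j k ≢ nb y i j′ k′ → nb y i j k ~ nb y i j′ k′
    nb-column : ∀ y j {i k i′ k′} → nb y i j k ≢ nb y i′ j k′ → nb y i j k ~ nb y i′ j k′
    0<a       : 0 ℕ.< a
    1<p       : 1 ℕ.< p
    1<r       : 1 ℕ.< r
    p≢r       : p ≢ r

module _ {n} {Γ : FiniteGraph n} {a : ℕ} where
  open FiniteGraph Γ

  -- Lines are defined below as columns only; a row is a column of the transposed grid. When r < p,
  -- the lines of `G` are the long ones and those of `transpose G` the short ones.
  transpose : ∀ {p r} → LocalGrid Γ a p r → LocalGrid Γ a r p
  transpose G = record
    { nb        = λ y i j k → nb y j i k
    ; nb-adj    = λ y i j k → nb-adj y j i k
    ; nb-sur    = λ y~z → let i , j , k , eq = nb-sur y~z in j , i , k , eq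
    ; nb-inj    = λ eq → let i , j , k = nb-inj eq in j , i , k
    ; nb-line   = Sum.swap ∘ nb-line
    ; nb-row    = nb-column
    ; nb-column = nb-row
    ; 0<a       = 0<a
    ; 1<p       = 1<r
    ; 1<r       = 1<p
    ; p≢r       = p≢r ∘ sym
    }
    where open LocalGrid G

  module _ {p r} (G : LocalGrid Γ a p r) where
    open LocalGrid G

    Column : Fin n → Fin r → Fin n → Set
    Column y j z = y ≡ z ⊎ (∃[ i ] ∃[ k ] nb y i j k ≡ z)

    column? : ∀ y j z → Dec (Column y j z)
    column? y j z = (y ≟ᶠ z) ⊎-dec any? λ i → any? λ k → nb y i j k ≟ᶠ z

    line : Fin n → Fin r → Subset n
    line y j = tabulate λ z → does (column? y j z)

    ∈-line : ∀ {y j z} → z ∈ line y j ⇔ Column y j z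
    ∈-line {y} {j} = ∈-tabulate (column? y j)

    base∈line : ∀ {y j} → y ∈ line y j
    base∈line = Equivalence.from ∈-line (inj₁ refl)

    nb∈line : ∀ {y i j k} → nb y i j k ∈ line y j
    nb∈line {i = i} {k = k} = Equivalence.from ∈-line (inj₂ (i , k , refl))

    nb≢ : ∀ {y i j k} → y ≢ nb y i j k
    nb≢ y≡ = ~-irrefl y≡ (nb-adj _ _ _ _)

    nb∈line⇒≡ : ∀ {y i j k j′} → nb y i j k ∈ line y j′ → j ≡ j′
    nb∈line⇒≡ nb∈ with Equivalence.to ∈-line nb∈
    ... | inj₁ y≡nb            = contradiction y≡nb nb≢
    ... | inj₂ (_ , _ , nb≡nb) = sym (proj₁ (proj₂ (nb-inj nb≡nb)))

    line-clique : ∀ y j → IsClique Γ (line y j)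
    line-clique y j u∈ v∈ u≢v with Equivalence.to ∈-line u∈ | Equivalence.to ∈-line v∈
    ... | inj₁ refl           | inj₁ refl           = contradiction refl u≢v
    ... | inj₁ refl           | inj₂ (i , k , refl) = nb-adj y i j k
    ... | inj₂ (i , k , refl) | inj₁ refl           = ~-sym (nb-adj y i j k)
    ... | inj₂ (i , k , refl) | inj₂ (_ , _ , refl) = nb-column y j u≢v

    -- In place of a reindexing along the bijection between neighbours and cells, the adjacency
    -- indicator is expanded into Kronecker deltas over the cells, and the sums are exchanged.
    nb-∑ : ∀ y (f : Fin n → ℕ) → ∑[ z < n ] (ind (y ~? z) ℕ.* f z) ≡
           ∑[ i < p ] ∑[ j < r ] ∑[ k < a ] f (nb y i j k)
    nb-∑ y f = begin
      ∑[ z < n ] (ind (y ~? z) ℕ.* f z)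
        ≡⟨ sum-cong-≗ pointwise ⟩
      ∑[ z < n ] ∑[ i < p ] ∑[ j < r ] ∑[ k < a ] δ i j k z
        ≡⟨ ∑-comm (λ z i → ∑[ j < r ] ∑[ k < a ] δ i j k z) ⟩
      ∑[ i < p ] ∑[ z < n ] ∑[ j < r ] ∑[ k < a ] δ i j k z
        ≡⟨ sum-cong-≗ (λ i → trans (∑-comm (λ z j → ∑[ k < a ] δ i j k z))
             (sum-cong-≗ λ j → trans (∑-comm (λ z k → δ i j k z))
               (sum-cong-≗ λ k → ∑-δ (nb y i j k) f))) ⟩
      ∑[ i < p ] ∑[ j < r ] ∑[ k < a ] f (nb y i j k) ∎
      where
      open ≡-Reasoning
      δ : Fin p → Fin r → Fin a → Fin n → ℕ
      δ i j k z = ind (nb y i j k ≟ᶠ z) ℕ.* f z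
      δ≡0 : ∀ i j k z → nb y i j k ≢ z → δ i j k z ≡ 0
      δ≡0 i j k z ≢z = cong (ℕ._* f z) (ind-false (nb y i j k ≟ᶠ z) ≢z)
      pointwise : ∀ z → ind (y ~? z) ℕ.* f z ≡ ∑[ i < p ] ∑[ j < r ] ∑[ k < a ] δ i j k z
      pointwise z with y ~? z
      ... | no ¬y~z = sym (∑-zero p λ i → ∑-zero r λ j → ∑-zero a λ k → δ≡0 i j k z λ where refl → ¬y~z (nb-adj y i j k))
      ... | yes y~z with nb-sur y~z
      ...   | i , j , k , refl = sym (begin
        ∑[ i′ < p ] ∑[ j′ < r ] ∑[ k′ < a ] δ i′ j′ k′ z
          ≡⟨ ∑-single _ i (λ i′ i′≢i → ∑-zero r λ j′ → ∑-zero a λ k′ → δ≡0 i′ j′ k′ z (i′≢i ∘ proj₁ ∘ nb-inj)) ⟩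
        ∑[ j′ < r ] ∑[ k′ < a ] δ i j′ k′ z
          ≡⟨ ∑-single _ j (λ j′ j′≢j → ∑-zero a λ k′ → δ≡0 i j′ k′ z (j′≢j ∘ proj₁ ∘ proj₂ ∘ nb-inj)) ⟩
        ∑[ k′ < a ] δ i j k′ z
          ≡⟨ ∑-single _ k (λ k′ k′≢k → δ≡0 i j k′ z (k′≢k ∘ proj₂ ∘ proj₂ ∘ nb-inj)) ⟩
        δ i j k z
          ≡⟨ cong (ℕ._* f z) (ind-true (nb y i j k ≟ᶠ z) refl) ⟩
        1 ℕ.* f z ∎)

    line-∑ : ∀ y j (f : Fin n → ℕ) → ∑[ z < n ] (ind (z ∈? line y j) ℕ.* f z) ≡
             f y ℕ.+ ∑[ i < p ] ∑[ k < a ] f (nb y i j k)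
    line-∑ y j f = begin
      ∑[ z < n ] (ind (z ∈? line y j) ℕ.* f z)
        ≡⟨ sum-cong-≗ pointwise ⟩
      ∑[ z < n ] (ind (y ≟ᶠ z) ℕ.* f z ℕ.+ ∑[ i < p ] ∑[ k < a ] δ i k z)
        ≡⟨ ∑-distrib-+ _ (λ z → ∑[ i < p ] ∑[ k < a ] δ i k z) ⟩
      ∑[ z < n ] (ind (y ≟ᶠ z) ℕ.* f z) ℕ.+ ∑[ z < n ] ∑[ i < p ] ∑[ k < a ] δ i k z
        ≡⟨ cong₂ ℕ._+_ (∑-δ y f) (trans (∑-comm (λ z i → ∑[ k < a ] δ i k z))
             (sum-cong-≗ λ i → trans (∑-comm (λ z k → δ i k z))
               (sum-cong-≗ λ k → ∑-δ (nb y i j k) f))) ⟩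
      f y ℕ.+ ∑[ i < p ] ∑[ k < a ] f (nb y i j k) ∎
      where
      open ≡-Reasoning
      δ : Fin p → Fin a → Fin n → ℕ
      δ i k z = ind (nb y i j k ≟ᶠ z) ℕ.* f z
      δ≡0 : ∀ i k z → nb y i j k ≢ z → δ i k z ≡ 0
      δ≡0 i k z ≢z = cong (ℕ._* f z) (ind-false (nb y i j k ≟ᶠ z) ≢z)
      pointwise : ∀ z → ind (z ∈? line y j) ℕ.* f z ≡
                  ind (y ≟ᶠ z) ℕ.* f z ℕ.+ ∑[ i < p ] ∑[ k < a ] δ i k z
      pointwise z with z ∈? line y j
      ... | no z∉ = sym (cong₂ ℕ._+_
              (cong (ℕ._* f z) (ind-false (y ≟ᶠ z) λ where refl → z∉ base∈line))
              (∑-zero p λ i → ∑-zero a λ k → δ≡0 i k z λ where refl → z∉ nb∈line))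
      ... | yes z∈ with Equivalence.to ∈-line z∈
      ...   | inj₁ refl = sym (trans (cong₂ ℕ._+_
              (cong (ℕ._* f y) (ind-true (y ≟ᶠ y) refl))
              (∑-zero p λ i → ∑-zero a λ k → δ≡0 i k z (nb≢ ∘ sym))) (ℕ.+-identityʳ _))
      ...   | inj₂ (i , k , refl) = sym (cong₂ ℕ._+_
              (cong (ℕ._* f z) (ind-false (y ≟ᶠ z) nb≢))
              (begin
        ∑[ i′ < p ] ∑[ k′ < a ] δ i′ k′ z
          ≡⟨ ∑-single _ i (λ i′ i′≢i → ∑-zero a λ k′ → δ≡0 i′ k′ z (i′≢i ∘ proj₁ ∘ nb-inj)) ⟩
        ∑[ k′ < a ] δ i k′ z
          ≡⟨ ∑-single _ k (λ k′ k′≢k → δ≡0 i k′ z (k′≢k ∘ proj₂ ∘ proj₂ ∘ nb-inj)) ⟩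
        δ i k z
          ≡⟨ cong (ℕ._* f z) (ind-true (nb y i j k ≟ᶠ z) refl) ⟩
        1 ℕ.* f z ∎))

    ∣line∣ : ∀ y j → ∣ line y j ∣ ≡ suc (p ℕ.* a)
    ∣line∣ y j = begin
      ∣ line y j ∣                                  ≡⟨ ∣∣≡∑ (line y j) ⟩
      ∑[ z < n ] ind (z ∈? line y j)                ≡⟨ sum-cong-≗ (λ z → ℕ.*-identityʳ (ind (z ∈? line y j))) ⟨
      ∑[ z < n ] (ind (z ∈? line y j) ℕ.* 1)          ≡⟨ line-∑ y j (λ _ → 1) ⟩
      suc (∑[ i < p ] ∑[ k < a ] 1)
        ≡⟨ cong suc (∑-const p a λ _ → trans (∑-const a 1 λ _ → refl) (ℕ.*-identityʳ a)) ⟩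
      suc (p ℕ.* a)                                 ∎
      where open ≡-Reasoning

  module _ {p r} (G : LocalGrid Γ a p r) where
    open LocalGrid G

    -- Let z in M lie in cell (i , j). If some w in M leaves column j, then w shares row i with z. A
    -- vertex of M outside row i would have to share its column with both z and w, whose columns
    -- differ; so all of M lies in row i. If M is just y, any column will do.
    clique⊆line : ∀ {M y} → IsClique Γ M → y ∈ M →
      (∃[ j ] M ⊆ line G y j) ⊎ (∃[ i ] M ⊆ line (transpose G) y i)
    clique⊆line {M} {y} clique y∈M with any? (λ z → (z ∈? M) ×-dec ¬? (y ≟ᶠ z))
    ... | no none = inj₁ (fromℕ< (ℕ.<-trans ℕ.z<s 1<r) , λ {z} z∈M →
            case y ≟ᶠ z of λ where
              (yes refl) → base∈line G
              (no y≢z)   → contradiction (z , z∈M , y≢z) none)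
    ... | yes (z , z∈M , y≢z) with nb-sur (clique y∈M z∈M y≢z)
    ...   | i , j , k , refl with any? (λ w → (w ∈? M) ×-dec ¬? (w ∈? line G y j))
    ...     | no none = inj₁ (j , λ {w} w∈M → decidable-stable (w ∈? line G y j) λ w∉ → none (w , w∈M , w∉))
    ...     | yes (w , w∈M , w∉) with nb-sur (clique y∈M w∈M λ where refl → w∉ (base∈line G))
    ...       | i′ , j′ , k′ , refl = inj₂ (i , λ {u} u∈M → case y ≟ᶠ u of λ where
                  (yes refl) → base∈line (transpose G)
                  (no y≢u)   → case nb-sur (clique y∈M u∈M y≢u) of λ where
                    (i″ , j″ , k″ , refl) →
                      subst (λ t → nb y i″ j″ k″ ∈ line (transpose G) y t) (sym (same-row u∈M)) (nb∈line (transpose G)))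
      where
      j≢j′ : j ≢ j′
      j≢j′ refl = w∉ (nb∈line G)
      i≡i′ : i ≡ i′
      i≡i′ = case nb-line (clique z∈M w∈M (j≢j′ ∘ proj₁ ∘ proj₂ ∘ nb-inj)) of λ where
        (inj₁ eq) → eq
        (inj₂ eq) → contradiction eq j≢j′
      same-row : ∀ {i″ j″ k″} → nb y i″ j″ k″ ∈ M → i ≡ i″
      same-row {i″} {j″} {k″} u∈M with i ≟ᶠ i″
      ... | yes eq = eq
      ... | no i≢i″ with nb-line (clique z∈M u∈M (i≢i″ ∘ proj₁ ∘ nb-inj))
                       | nb-line (clique w∈M u∈M (i≢i″ ∘ trans i≡i′ ∘ proj₁ ∘ nb-inj))
      ...   | inj₁ eq   | _         = eq
      ...   | inj₂ _    | inj₁ eq   = trans i≡i′ eq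
      ...   | inj₂ refl | inj₂ refl = contradiction refl j≢j′

    -- A larger clique lies in a single column or row. It cannot lie in a row, because the line
    -- already meets two rows (`1<p`); so it lies in the same column.
    line-maximal : ∀ y j → IsMaximalClique Γ (line G y j)
    line-maximal y j = line-clique G y j , λ {C′} clique line⊆ →
      case clique⊆line clique (line⊆ (base∈line G)) of λ where
        (inj₁ (j′ , C′⊆)) → ⊆-antisym
          (subst (λ t → C′ ⊆ line G y t) (sym (nb∈line⇒≡ G (C′⊆ (line⊆ (nb∈line G {i = i₀} {k = k₀}))))) C′⊆)
          line⊆
        (inj₂ (i′ , C′⊆)) → contradiction
          (trans (nb∈line⇒≡ (transpose G) (C′⊆ (line⊆ (nb∈line G {i = i₀} {k = k₀}))))
            (sym (nb∈line⇒≡ (transpose G) (C′⊆ (line⊆ (nb∈line G {i = i₁} {k = k₀}))))))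
          i₀≢i₁
      where
      k₀ : Fin a
      k₀ = fromℕ< 0<a
      two-distinct : ∀ {m} → 1 ℕ.< m → ∃[ s ] ∃[ t ] _≢_ {A = Fin m} s t
      two-distinct (ℕ.s<s ℕ.z<s) = zero , suc zero , λ ()
      i₀ i₁ : Fin p
      i₀ = proj₁ (two-distinct 1<p)
      i₁ = proj₁ (proj₂ (two-distinct 1<p))
      i₀≢i₁ : i₀ ≢ i₁
      i₀≢i₁ = proj₂ (proj₂ (two-distinct 1<p))

    maximal-clique : ∀ {M y} → IsMaximalClique Γ M → y ∈ M →
      (∃[ j ] M ≡ line G y j) ⊎ (∃[ i ] M ≡ line (transpose G) y i)
    maximal-clique (clique , maximal) y∈M with clique⊆line clique y∈M
    ... | inj₁ (j , M⊆) = inj₁ (j , sym (maximal (line-clique G _ j) M⊆))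
    ... | inj₂ (i , M⊆) = inj₂ (i , sym (maximal (line-clique (transpose G) _ i) M⊆))

    -- Since p ≢ r, the size of a line tells the two families apart.
    line≢lineᵀ : ∀ {y j z i} → line G y j ≢ line (transpose G) z i
    line≢lineᵀ {y} {j} {z} {i} eq = p≢r (ℕ.*-cancelʳ-≡ p r a {{ℕ.>-nonZero 0<a}} (ℕ.suc-injective
      (trans (sym (∣line∣ G y j)) (trans (cong ∣_∣ eq) (∣line∣ (transpose G) z i)))))

    -- The grids at different vertices are unrelated coordinate systems. Maximality makes a line at
    -- y a line at each of its points x, and its size keeps it in the same family, so the two
    -- families are global.
    line-rebase : ∀ {x y j} → x ∈ line G y j → ∃[ j′ ] line G y j ≡ line G x j′
    line-rebase {x} {y} {j} x∈ with maximal-clique (line-maximal y j) x∈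
    ... | inj₁ eq       = eq
    ... | inj₂ (i , eq) = contradiction eq line≢lineᵀ

-- Walks and distances

module _ {n} (Γ : FiniteGraph n) where
  open FiniteGraph Γ

  walk-snoc : ∀ {l x y z} → Walk Γ l x y → y ~ z → Walk Γ (suc l) x z
  walk-snoc {zero}  refl            y~z = _ , y~z , refl
  walk-snoc {suc l} (w , x~w , w→y) y~z = w , x~w , walk-snoc w→y y~z

  distance-unique : ∀ {x y i j} → Distance Γ x y i → Distance Γ x y j → i ≡ j
  distance-unique (wi , ¬<i) (wj , ¬<j) =
    ℕ.≤-antisym (ℕ.≮⇒≥ λ j<i → ¬<i j<i wj) (ℕ.≮⇒≥ λ i<j → ¬<j i<j wi)

  distance-adj : ∀ {x y z i j} → Distance Γ x y i → Distance Γ x z j → y ~ z → j ℕ.≤ suc i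
  distance-adj (wi , _) (_ , ¬<j) y~z = ℕ.≮⇒≥ λ 1+i<j → ¬<j 1+i<j (walk-snoc wi y~z)

  distance-1 : ∀ {x y} → Distance Γ x y 1 ⇔ x ~ y
  distance-1 = mk⇔ (λ { ((_ , x~z , refl) , _) → x~z })
    λ x~y → (_ , x~y , refl) , λ where ℕ.z<s x≡y → ~-irrefl x≡y x~y

  distance-exists : Connected Γ → ∀ x y → ∃[ i ] Distance Γ x y i
  distance-exists connected x y = let l , walk = connected x y in shortest walk (<-wellFounded l)
    where
    shortest : ∀ {l} → Walk Γ l x y → Acc ℕ._<_ l → ∃[ i ] Distance Γ x y i
    shortest {l} walk (acc smaller) with ℕ.anyUpTo? (λ m → walk? Γ m x y) l
    ... | yes (m , m<l , walk′) = shortest walk′ (smaller m<l)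
    ... | no none               = l , walk , λ m<l walk′ → none (_ , m<l , walk′)

  ∈-sphere : ∀ {i x y} → y ∈ Sphere Γ i x ⇔ Distance Γ x y i
  ∈-sphere {i} {x} = ∈-tabulate λ y → distance? Γ x y i

-- Near lines

-- Here `g h` stands for [h], `forward` for b_h and `backward` for c_{h+1}. Both values are kept
-- factored in the way in which counting by cells and by lines produces them.
record GridMetric {n : ℕ} (Γ : FiniteGraph n) (a p r : ℕ) (g : ℕ → ℕ) : Set where
  open FiniteGraph Γ
  field
    d        : Fin n → Fin n → ℕ
    distance : ∀ x y → Distance Γ x y (d x y)
    g-zero   : g 0 ≡ 0
    forward  : ∀ x y → ∑[ z < n ] (ind (y ~? z) ℕ.* ind (d x z ℕ.≟ suc (d x y))) ≡
               (p ∸ g (d x y)) ℕ.* ((r ∸ g (d x y)) ℕ.* a)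
    backward : ∀ {x y h} → d x y ≡ suc h → ∑[ z < n ] (ind (y ~? z) ℕ.* ind (d x z ℕ.≟ h)) ≡
               g (suc h) ℕ.* suc (g h ℕ.* a)

module _ {n} {Γ : FiniteGraph n} {a P R : ℕ} {g : ℕ → ℕ} (metric : GridMetric Γ a P R g) where
  open FiniteGraph Γ
  open GridMetric metric

  private
    d-adj : ∀ x {y z} → y ~ z → d x z ℕ.≤ suc (d x y)
    d-adj x {y} {z} = distance-adj Γ (distance x y) (distance x z)

  -- `p` and `r` are independent of `P` and `R`, so that what follows applies to a grid and to its
  -- transpose alike; only `farCells`, which uses `forward`, fixes the orientation.
  module _ {p r} (G : LocalGrid Γ a p r) where
    open LocalGrid G

    -- The successor stands on the left to avoid truncated subtraction: at distance 0 no line is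
    -- near.
    Near : Fin n → Fin n → Fin r → Set
    Near x y j = ∃[ i ] ∃[ k ] suc (d x (nb y i j k)) ≡ d x y

    near? : ∀ x y j → Dec (Near x y j)
    near? x y j = any? λ i → any? λ k → suc (d x (nb y i j k)) ℕ.≟ d x y

    -- In `LineCount` the base point y is itself a point of the line closest to x, so the distance
    -- from x to the line is h without a separate notion of distance to a set.
    LineCount NearCount : ℕ → Set
    LineCount h = ∀ {x y j} → d x y ≡ h → (∀ {z} → z ∈ line G y j → h ℕ.≤ d x z) →
      ∑[ z < n ] (ind (z ∈? line G y j) ℕ.* ind (d x z ℕ.≟ h)) ≡ suc (g h ℕ.* a)
    NearCount h = ∀ {x y} → d x y ≡ h → ∑[ j < r ] ind (near? x y j) ≡ g h

    -- All other points of the line are adjacent to the point that is one step nearer to x than y.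
    near⇒≤ : ∀ {x y j} → Near x y j → ∀ i k → d x (nb y i j k) ℕ.≤ d x y
    near⇒≤ {x} {y} {j} (i′ , k′ , eq) i k with nb y i′ j k′ ≟ᶠ nb y i j k
    ... | yes same = ℕ.≤-trans (ℕ.n≤1+n _) (ℕ.≤-reflexive (trans (cong (suc ∘ d x) (sym same)) eq))
    ... | no apart = ℕ.≤-trans (d-adj x (nb-column y j apart)) (ℕ.≤-reflexive eq)

    line-≥ : ∀ {x y j z} → z ∈ line G y j → d x y ℕ.≤ suc (d x z)
    line-≥ {x} z∈ with Equivalence.to (∈-line G) z∈
    ... | inj₁ refl           = ℕ.n≤1+n _
    ... | inj₂ (i , k , refl) = d-adj x (~-sym (nb-adj _ i _ k))

    nearCount-zero : NearCount 0
    nearCount-zero {x} {y} dxy≡0 = trans (∑-zero r λ j → ind-false (near? x y j) λ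
      (_ , _ , eq) → contradiction (trans eq dxy≡0) λ ()) (sym g-zero)

    -- The neighbours counted by c_{h+1} are sorted by the line through y that contains them. A near
    -- line contributes `suc (g h * a)` of them and any other line none, so this positive factor
    -- cancels from c_{h+1}.
    nearCount-suc : ∀ {h} → LineCount h → NearCount (suc h)
    nearCount-suc {h} lineCount {x} {y} dxy≡ = ℕ.*-cancelʳ-≡ _ _ (suc (g h ℕ.* a)) (begin
      ∑[ j < r ] ind (near? x y j) ℕ.* suc (g h ℕ.* a)
        ≡⟨ *-distribʳ-sum (suc (g h ℕ.* a)) (λ j → ind (near? x y j)) ⟩
      ∑[ j < r ] (ind (near? x y j) ℕ.* suc (g h ℕ.* a))
        ≡⟨ sum-cong-≗ (λ j → on-line j (near? x y j)) ⟨
      ∑[ j < r ] ∑[ i < p ] ∑[ k < a ] at (nb y i j k)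
        ≡⟨ ∑-comm (λ j i → ∑[ k < a ] at (nb y i j k)) ⟩
      ∑[ i < p ] ∑[ j < r ] ∑[ k < a ] at (nb y i j k)
        ≡⟨ nb-∑ G y at ⟨
      ∑[ z < n ] (ind (y ~? z) ℕ.* at z)
        ≡⟨ backward dxy≡ ⟩
      g (suc h) ℕ.* suc (g h ℕ.* a) ∎)
      where
      open ≡-Reasoning
      at : Fin n → ℕ
      at z = ind (d x z ℕ.≟ h)
      on-line : ∀ j (near : Dec (Near x y j)) →
        ∑[ i < p ] ∑[ k < a ] at (nb y i j k) ≡ ind near ℕ.* suc (g h ℕ.* a)
      on-line j (no ¬near) = ∑-zero p λ i → ∑-zero a λ k → ind-false (d x (nb y i j k) ℕ.≟ h)
        λ eq → ¬near (i , k , trans (cong suc eq) (sym dxy≡))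
      -- Rebased at its point at distance h, the near line satisfies the hypotheses of
      -- `LineCount h`. Its old base point y may be added to the sum freely, being at distance h +
      -- 1.
      on-line j (yes (i , k , near)) with line-rebase G (nb∈line G {y} {i} {j} {k})
      ... | j′ , same = begin
        ∑[ i′ < p ] ∑[ k′ < a ] at (nb y i′ j k′)
          ≡⟨ cong (ℕ._+ ∑[ i′ < p ] ∑[ k′ < a ] at (nb y i′ j k′))
               (ind-false (d x y ℕ.≟ h) λ eq → ℕ.1+n≢n (trans (sym dxy≡) eq)) ⟨
        at y ℕ.+ ∑[ i′ < p ] ∑[ k′ < a ] at (nb y i′ j k′)
          ≡⟨ line-∑ G y j at ⟨
        ∑[ z < n ] (ind (z ∈? line G y j) ℕ.* at z)
          ≡⟨ cong (λ M → ∑[ z < n ] (ind (z ∈? M) ℕ.* at z)) same ⟩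
        ∑[ z < n ] (ind (z ∈? line G (nb y i j k) j′) ℕ.* at z)
          ≡⟨ lineCount (ℕ.suc-injective (trans near dxy≡)) (λ {z} z∈ →
               ℕ.s≤s⁻¹ (subst (ℕ._≤ suc (d x z)) dxy≡ (line-≥ (subst (z ∈_) (sym same) z∈)))) ⟩
        suc (g h ℕ.* a)
          ≡⟨ ℕ.*-identityˡ _ ⟨
        1 ℕ.* suc (g h ℕ.* a) ∎

  module _ {p r} (G : LocalGrid Γ a p r) where
    open LocalGrid G

    FarCells : ℕ → Set
    FarCells h = ∀ {x y} → d x y ≡ h → ∀ i j k →
      ¬ Near (transpose G) x y i → ¬ Near G x y j → d x (nb y i j k) ≡ suc h

    -- As y is a closest point, column j is not near. Its cell in row i is then at distance h if row
    -- i is near and at distance h + 1 otherwise, which leaves y and one a-clique for each near row.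
    lineCount : ∀ {h} → NearCount (transpose G) h → FarCells h → LineCount G h
    lineCount {h} nearCount far {x} {y} {j} dxy≡ beyond = begin
      ∑[ z < n ] (ind (z ∈? line G y j) ℕ.* at z)
        ≡⟨ line-∑ G y j at ⟩
      at y ℕ.+ ∑[ i < p ] ∑[ k < a ] at (nb y i j k)
        ≡⟨ cong₂ ℕ._+_ (ind-true (d x y ℕ.≟ h) dxy≡)
             (sum-cong-≗ λ i → ∑-const a _ λ k → at-nb i k (near? (transpose G) x y i)) ⟩
      suc (∑[ i < p ] (a ℕ.* ind (near? (transpose G) x y i)))
        ≡⟨ cong suc (sym (*-distribˡ-sum a (λ i → ind (near? (transpose G) x y i)))) ⟩
      suc (a ℕ.* ∑[ i < p ] ind (near? (transpose G) x y i))
        ≡⟨ cong (λ t → suc (a ℕ.* t)) (nearCount dxy≡) ⟩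
      suc (a ℕ.* g h)
        ≡⟨ cong suc (ℕ.*-comm a (g h)) ⟩
      suc (g h ℕ.* a) ∎
      where
      open ≡-Reasoning
      at : Fin n → ℕ
      at z = ind (d x z ℕ.≟ h)
      ¬near : ¬ Near G x y j
      ¬near (i , k , eq) = ℕ.<⇒≱ (ℕ.≤-reflexive (trans eq dxy≡)) (beyond (nb∈line G))
      at-nb : ∀ i k (near : Dec (Near (transpose G) x y i)) → at (nb y i j k) ≡ ind near
      at-nb i k (yes near) = ind-true (d x (nb y i j k) ℕ.≟ h) (ℕ.≤-antisym
        (ℕ.≤-trans (near⇒≤ (transpose G) near j k) (ℕ.≤-reflexive dxy≡)) (beyond (nb∈line G)))
      at-nb i k (no ¬nearᵀ) = ind-false (d x (nb y i j k) ℕ.≟ h) λ eq →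
        ℕ.1+n≢n (trans (sym (far dxy≡ i j k ¬nearᵀ ¬near)) eq)

  module _ (G : LocalGrid Γ a P R) where
    open LocalGrid G

    -- No neighbour on a near line is at distance h + 1, so the value of b_h leaves no room
    -- for a neighbour off the near lines at a smaller distance.
    farCells : ∀ {h} → NearCount G h → NearCount (transpose G) h → FarCells G h
    farCells {h} nearCount nearCountᵀ {x} {y} dxy≡ i j k ¬nearᵀ ¬near =
      decidable-stable (d x (nb y i j k) ℕ.≟ suc h) λ ≢ → contradiction
        (trans (sym (ind-false (d x (nb y i j k) ℕ.≟ suc h) ≢))
          (trans (tight i j k) (cong₂ ℕ._*_ (ind-true (¬? (near? (transpose G) x y i)) ¬nearᵀ)
                                            (ind-true (¬? (near? G x y j)) ¬near))))
        λ ()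
      where
      open ≡-Reasoning
      rowFar : Fin P → ℕ
      rowFar i = ind (¬? (near? (transpose G) x y i))
      columnFar : Fin R → ℕ
      columnFar j = ind (¬? (near? G x y j))
      at : Fin n → ℕ
      at z = ind (d x z ℕ.≟ suc h)
      at≤ : ∀ i j k → at (nb y i j k) ℕ.≤ rowFar i ℕ.* columnFar j
      at≤ i j k = ind-≤ (d x (nb y i j k) ℕ.≟ suc h) λ eq →
        let too-far = λ (≤y : d x (nb y i j k) ℕ.≤ d x y) → ℕ.1+n≰n (subst₂ ℕ._≤_ eq dxy≡ ≤y)
        in ℕ.≤-reflexive (sym (cong₂ ℕ._*_
          (ind-true (¬? (near? (transpose G) x y i)) λ near → too-far (near⇒≤ (transpose G) near j k))
          (ind-true (¬? (near? G x y j)) λ near → too-far (near⇒≤ G near i k))))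
      total : ∑[ i < P ] ∑[ j < R ] ∑[ k < a ] at (nb y i j k) ≡
              ∑[ i < P ] ∑[ j < R ] ∑[ k < a ] (rowFar i ℕ.* columnFar j)
      total = begin
        ∑[ i < P ] ∑[ j < R ] ∑[ k < a ] at (nb y i j k)
          ≡⟨ nb-∑ G y at ⟨
        ∑[ z < n ] (ind (y ~? z) ℕ.* at z)
          ≡⟨ subst (λ t → ∑[ z < n ] (ind (y ~? z) ℕ.* ind (d x z ℕ.≟ suc t)) ≡ (P ∸ g t) ℕ.* ((R ∸ g t) ℕ.* a))
               dxy≡ (forward x y) ⟩
        (P ∸ g h) ℕ.* ((R ∸ g h) ℕ.* a)
          ≡⟨ cong₂ (λ s t → s ℕ.* (t ℕ.* a))
               (trans (∑-ind-¬ (near? (transpose G) x y)) (cong (P ∸_) (nearCountᵀ dxy≡)))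
               (trans (∑-ind-¬ (near? G x y)) (cong (R ∸_) (nearCount dxy≡))) ⟨
        sum rowFar ℕ.* (sum columnFar ℕ.* a)
          ≡⟨ *-distribʳ-sum _ rowFar ⟩
        ∑[ i < P ] (rowFar i ℕ.* (sum columnFar ℕ.* a))
          ≡⟨ sum-cong-≗ (λ i → begin
               rowFar i ℕ.* (sum columnFar ℕ.* a)          ≡⟨ ℕ.*-assoc (rowFar i) _ a ⟨
               rowFar i ℕ.* sum columnFar ℕ.* a            ≡⟨ cong (ℕ._* a) (*-distribˡ-sum (rowFar i) columnFar) ⟩
               ∑[ j < R ] (rowFar i ℕ.* columnFar j) ℕ.* a ≡⟨ *-distribʳ-sum a (λ j → rowFar i ℕ.* columnFar j) ⟩
               ∑[ j < R ] (rowFar i ℕ.* columnFar j ℕ.* a)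
                 ≡⟨ sum-cong-≗ (λ j → trans (ℕ.*-comm _ a) (sym (∑-const a (rowFar i ℕ.* columnFar j) λ _ → refl))) ⟩
               ∑[ j < R ] ∑[ k < a ] (rowFar i ℕ.* columnFar j) ∎) ⟩
        ∑[ i < P ] ∑[ j < R ] ∑[ k < a ] (rowFar i ℕ.* columnFar j) ∎
      -- Equality of the totals descends through the three nested sums: to each row, then to each
      -- cell of the row, then to each point of the cell.
      tight : ∀ i j k → at (nb y i j k) ≡ rowFar i ℕ.* columnFar j
      tight i j = ∑-tight (at≤ i j) (ℕ.≤-reflexive (sym
        (∑-tight (λ j → ∑-mono-≤ (at≤ i j)) (ℕ.≤-reflexive (sym
          (∑-tight (λ i → ∑-mono-≤ λ j → ∑-mono-≤ (at≤ i j)) (ℕ.≤-reflexive (sym total)) i))) j)))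

    -- The recursion descends only through `near-at`: near counts at h + 1 need line counts at h,
    -- whereas line counts at h need near counts of both families at h. Beyond the diameter the
    -- claims are vacuous, so h needs no bound.
    counts : ∀ h → (NearCount G h × NearCount (transpose G) h) ×
                   (LineCount G h × LineCount (transpose G) h)
    counts h = near , lineCount G (proj₂ near) far
                    -- The double transpose has definitionally the same `nb` as `G`, the only field
                    -- that near lines depend on, so the near count of `G` fits as it is.
                    , lineCount (transpose G) (proj₁ near) λ dxy≡ i j k ¬nearᵀ ¬near → far dxy≡ j i k ¬near ¬nearᵀ
      where
      near-at : ∀ h → NearCount G h × NearCount (transpose G) h
      near-at zero    = nearCount-zero G , nearCount-zero (transpose G)
      near-at (suc h) = let _ , line , lineᵀ = counts h in nearCount-suc G line , nearCount-suc (transpose G) lineᵀ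
      near : NearCount G h × NearCount (transpose G) h
      near = near-at h
      far : FarCells G h
      far = farCells (proj₁ near) (proj₂ near)

-- Rationals and null sequences

fromℤ-+ : ∀ x y → fromℤ (x ℤ.+ y) ≡ fromℤ x + fromℤ y
fromℤ-+ x y = ℚ.toℚᵘ-injective (ℚᵘ.≃-trans
  (ℚᵘ.*≡* (cong (ℤ._* 1ℤ) (sym (cong₂ ℤ._+_ (ℤ.*-identityʳ x) (ℤ.*-identityʳ y)))))
  (ℚᵘ.≃-sym (ℚ.toℚᵘ-homo-+ (fromℤ x) (fromℤ y))))

fromℤ-* : ∀ x y → fromℤ (x ℤ.* y) ≡ fromℤ x * fromℤ y
fromℤ-* x y = ℚ.toℚᵘ-injective (ℚᵘ.≃-sym (ℚ.toℚᵘ-homo-* (fromℤ x) (fromℤ y)))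

fromℕ-+ : ∀ m n → fromℕ (m ℕ.+ n) ≡ fromℕ m + fromℕ n
fromℕ-+ m n = fromℤ-+ (ℤ.+ m) (ℤ.+ n)

fromℕ-* : ∀ m n → fromℕ (m ℕ.* n) ≡ fromℕ m * fromℕ n
fromℕ-* m n = trans (cong fromℤ (ℤ.pos-* m n)) (fromℤ-* (ℤ.+ m) (ℤ.+ n))

fromℕ-injective : ∀ {m n} → fromℕ m ≡ fromℕ n → m ≡ n
fromℕ-injective = ℤ.+-injective ∘ cong ℚ.numerator

fromℕ-cancel-< : ∀ {m n} → fromℕ m ℚ.< fromℕ n → m ℕ.< n
fromℕ-cancel-< {m} {n} m<n = ℤ.drop‿+<+ (subst₂ ℤ._<_ (ℤ.*-identityʳ (ℤ.+ m)) (ℤ.*-identityʳ (ℤ.+ n)) (ℚ.drop-*<* m<n))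

fromℕ-mono-≤ : ∀ {m n} → m ℕ.≤ n → fromℕ m ℚ.≤ fromℕ n
fromℕ-mono-≤ {m} {n} m≤n =
  ℚ.*≤* (subst₂ ℤ._≤_ (sym (ℤ.*-identityʳ (ℤ.+ m))) (sym (ℤ.*-identityʳ (ℤ.+ n))) (ℤ.+≤+ m≤n))

fromℕ-mono-< : ∀ {m n} → m ℕ.< n → fromℕ m ℚ.< fromℕ n
fromℕ-mono-< {m} {n} m<n =
  ℚ.*<* (subst₂ ℤ._<_ (sym (ℤ.*-identityʳ (ℤ.+ m))) (sym (ℤ.*-identityʳ (ℤ.+ n))) (ℤ.+<+ m<n))

fromℕ-nonNeg : ∀ n → ℚ.NonNegative (fromℕ n)
fromℕ-nonNeg n = ℚ.nonNegative (fromℕ-mono-≤ (ℕ.z≤n {n}))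

fromℕ-∸ : ∀ {m n} → n ℕ.≤ m → fromℕ (m ∸ n) ≡ fromℕ m - fromℕ n
fromℕ-∸ {m} {n} n≤m = begin
  fromℕ (m ∸ n)                        ≡⟨ solve 2 (λ x y → x := (x :+ y) :- y) refl (fromℕ (m ∸ n)) (fromℕ n) ⟩
  fromℕ (m ∸ n) + fromℕ n - fromℕ n    ≡⟨ cong (_- fromℕ n) (fromℕ-+ (m ∸ n) n) ⟨
  fromℕ (m ∸ n ℕ.+ n) - fromℕ n        ≡⟨ cong (λ t → fromℕ t - fromℕ n) (ℕ.m∸n+n≡m n≤m) ⟩
  fromℕ m - fromℕ n                    ∎
  where
  open ≡-Reasoning
  open ℚSolver.+-*-Solver

fromℕ-∑ : ∀ {m} (f : Fin m → ℕ) → fromℕ (ℕΣ.sum f) ≡ ℚΣ.sum (fromℕ ∘ f)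
fromℕ-∑ {zero}  f = refl
fromℕ-∑ {suc m} f = trans (fromℕ-+ (f zero) _) (cong (fromℕ (f zero) +_) (fromℕ-∑ (f ∘ suc)))

0≤p*p : ∀ p → 0ℚ ℚ.≤ p * p
0≤p*p p = subst (0ℚ ℚ.≤_) (square (ℚ.∣p∣≡p∨∣p∣≡-p p))
  (ℚ.nonNegative⁻¹ _ {{ℚ.nonNeg*nonNeg⇒nonNeg ℚ.∣ p ∣ {{ℚ.∣-∣-nonNeg p}} ℚ.∣ p ∣ {{ℚ.∣-∣-nonNeg p}}}})
  where
  open ℚSolver.+-*-Solver
  square : ℚ.∣ p ∣ ≡ p ⊎ ℚ.∣ p ∣ ≡ ℚ.- p → ℚ.∣ p ∣ * ℚ.∣ p ∣ ≡ p * p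
  square (inj₁ eq) = cong₂ _*_ eq eq
  square (inj₂ eq) = trans (cong₂ _*_ eq eq) (solve 1 (λ x → (:- x) :* (:- x) := x :* x) refl p)

∑-nonNeg : ∀ {m} {f : Fin m → ℚ} → (∀ i → 0ℚ ℚ.≤ f i) → 0ℚ ℚ.≤ ℚΣ.sum f
∑-nonNeg {zero}  0≤f = ℚ.≤-refl
∑-nonNeg {suc m} 0≤f = ℚ.+-mono-≤ (0≤f zero) (∑-nonNeg (0≤f ∘ suc))

term≤∑ : ∀ {m} {f : Fin m → ℚ} → (∀ i → 0ℚ ℚ.≤ f i) → ∀ i → f i ℚ.≤ ℚΣ.sum f
term≤∑ {suc m} {f} 0≤f zero    = subst (ℚ._≤ ℚΣ.sum f) (ℚ.+-identityʳ _)
  (ℚ.+-monoʳ-≤ (f zero) (∑-nonNeg (0≤f ∘ suc)))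
term≤∑ {suc m} {f} 0≤f (suc i) = subst (ℚ._≤ ℚΣ.sum f) (ℚ.+-identityˡ _)
  (ℚ.+-mono-≤ (0≤f zero) (term≤∑ (0≤f ∘ suc) i))

-- `x ≈ᴿ y` unfolds to `Null` of the termwise difference, so equations between reals can be combined
-- as statements about rational sequences.
Null : (ℕ → ℚ) → Set
Null s = ∀ {ε} → 0ℚ ℚ.< ε → ∃[ N ] (∀ {i} → N ℕ.≤ i → ℚ.∣ s i ∣ ℚ.< ε)

null-cong : ∀ {s t} → (∀ i → s i ≡ t i) → Null s → Null t
null-cong s≗t null-s {ε} 0<ε with null-s 0<ε
... | N , small = N , λ {i} N≤i → subst (λ q → ℚ.∣ q ∣ ℚ.< ε) (s≗t i) (small N≤i)

null-+ : ∀ {s t} → Null s → Null t → Null (λ i → s i + t i)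
null-+ {s} {t} null-s null-t {ε} 0<ε with null-s ½ε-pos | null-t ½ε-pos
  where
  ½ε-pos : 0ℚ ℚ.< ½ * ε
  ½ε-pos = ℚ.positive⁻¹ _ {{ℚ.pos*pos⇒pos ½ ε {{ℚ.positive 0<ε}}}}
... | M , small-s | N , small-t = M ⊔ N , λ {i} M⊔N≤i → begin-strict
  ℚ.∣ s i + t i ∣         ≤⟨ ℚ.∣p+q∣≤∣p∣+∣q∣ (s i) (t i) ⟩
  ℚ.∣ s i ∣ + ℚ.∣ t i ∣   <⟨ ℚ.+-mono-< (small-s (ℕ.m⊔n≤o⇒m≤o M N M⊔N≤i)) (small-t (ℕ.m⊔n≤o⇒n≤o M N M⊔N≤i)) ⟩
  ½ * ε + ½ * ε           ≡⟨ ℚ.*-distribʳ-+ ε ½ ½ ⟨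
  (½ + ½) * ε             ≡⟨ ℚ.*-identityˡ ε ⟩
  ε                       ∎
  where open ℚ.≤-Reasoning

null-∑ : ∀ {m} {s : Fin m → ℕ → ℚ} → (∀ x → Null (s x)) → Null (λ i → ℚΣ.sum λ x → s x i)
null-∑ {zero}  null-s 0<ε = 0 , λ _ → 0<ε
null-∑ {suc m} null-s = null-+ (null-s zero) (null-∑ (null-s ∘ suc))

EventuallyBounded : (ℕ → ℚ) → Set
EventuallyBounded s = ∃[ B ] ∃[ N ] (0ℚ ℚ.< B × (∀ {i} → N ℕ.≤ i → ℚ.∣ s i ∣ ℚ.< B))

const-bounded : ∀ q → EventuallyBounded (λ _ → q)
const-bounded q = 1ℚ + ℚ.∣ q ∣ , 0 , ℚ.+-mono-<-≤ (ℚ.positive⁻¹ 1ℚ) (ℚ.0≤∣p∣ q) , λ _ →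
  subst (ℚ._< 1ℚ + ℚ.∣ q ∣) (ℚ.+-identityˡ _) (ℚ.+-monoˡ-< ℚ.∣ q ∣ (ℚ.positive⁻¹ 1ℚ))

cauchy-bounded : ∀ s → IsCauchy s → EventuallyBounded s
cauchy-bounded s cs with cs (ℚ.positive⁻¹ 1ℚ)
... | N , close = let C , _ , 0<C , sN<C = const-bounded (s N) in
  1ℚ + C , N , ℚ.+-mono-< (ℚ.positive⁻¹ 1ℚ) 0<C , λ {i} N≤i → begin-strict
    ℚ.∣ s i ∣                       ≡⟨ cong ℚ.∣_∣ (solve 2 (λ x y → x := (x :- y) :+ y) refl (s i) (s N)) ⟩
    ℚ.∣ s i - s N + s N ∣           ≤⟨ ℚ.∣p+q∣≤∣p∣+∣q∣ (s i - s N) (s N) ⟩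
    ℚ.∣ s i - s N ∣ + ℚ.∣ s N ∣     <⟨ ℚ.+-mono-< (close N≤i ℕ.≤-refl) (sN<C {0} ℕ.z≤n) ⟩
    1ℚ + C                          ∎
  where
  open ℚ.≤-Reasoning
  open ℚSolver.+-*-Solver

null-* : ∀ {s t} → EventuallyBounded s → Null t → Null (λ i → s i * t i)
null-* {s} {t} (B , M , 0<B , s<B) null-t {ε} 0<ε =
  let N , small = null-t {ε * 1/B} (ℚ.positive⁻¹ _ {{ℚ.pos*pos⇒pos ε {{ℚ.positive 0<ε}} 1/B {{ℚ.1/pos⇒pos B}}}})
  in M ⊔ N , λ {i} M⊔N≤i → begin-strict
    ℚ.∣ s i * t i ∣        ≡⟨ ℚ.∣p*q∣≡∣p∣*∣q∣ (s i) (t i) ⟩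
    ℚ.∣ s i ∣ * ℚ.∣ t i ∣  ≤⟨ ℚ.*-monoʳ-≤-nonNeg ℚ.∣ t i ∣ {{ℚ.∣-∣-nonNeg (t i)}} (ℚ.<⇒≤ (s<B (ℕ.m⊔n≤o⇒m≤o M N M⊔N≤i))) ⟩
    B * ℚ.∣ t i ∣          <⟨ ℚ.*-monoʳ-<-pos B (small (ℕ.m⊔n≤o⇒n≤o M N M⊔N≤i)) ⟩
    B * (ε * 1/B)          ≡⟨ solve 3 (λ b e c → b :* (e :* c) := e :* (c :* b)) refl B ε 1/B ⟩
    ε * (1/B * B)          ≡⟨ cong (ε *_) (ℚ.*-inverseˡ B) ⟩
    ε * 1ℚ                 ≡⟨ ℚ.*-identityʳ ε ⟩
    ε                      ∎
  where
  open ℚ.≤-Reasoning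
  open ℚSolver.+-*-Solver
  instance
    B-pos : ℚ.Positive B
    B-pos = ℚ.positive 0<B
    B-nonZero : ℚ.NonZero B
    B-nonZero = ℚ.pos⇒nonZero B
  1/B : ℚ
  1/B = ℚ.1/ B

p≤∣p∣ : ∀ p → p ℚ.≤ ℚ.∣ p ∣
p≤∣p∣ p with ℚ.≤-total 0ℚ p
... | inj₁ 0≤p = ℚ.≤-reflexive (sym (ℚ.0≤p⇒∣p∣≡p 0≤p))
... | inj₂ p≤0 = ℚ.≤-trans p≤0 (ℚ.0≤∣p∣ p)

-- If the absolute value of t were at least ε, then s would be at least ε². It serves to pass from
-- the squared norm of the eigenvector to its coordinates.
null-√ : ∀ {s t} → (∀ i → t i * t i ℚ.≤ s i) → Null s → Null t
null-√ {s} {t} t²≤s null-s {ε} 0<ε =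
  let N , small = null-s {ε * ε} (ℚ.positive⁻¹ _ {{ℚ.pos*pos⇒pos ε ε}})
  in N , λ {i} N≤i → ℚ.≰⇒> λ ε≤∣t∣ → ℚ.<-irrefl refl (begin-strict
    ε * ε                  ≤⟨ ℚ.*-monoˡ-≤-nonNeg ε {{ℚ.pos⇒nonNeg ε}} ε≤∣t∣ ⟩
    ε * ℚ.∣ t i ∣          ≤⟨ ℚ.*-monoʳ-≤-nonNeg ℚ.∣ t i ∣ {{ℚ.∣-∣-nonNeg (t i)}} ε≤∣t∣ ⟩
    ℚ.∣ t i ∣ * ℚ.∣ t i ∣  ≡⟨ ℚ.∣p*q∣≡∣p∣*∣q∣ (t i) (t i) ⟨
    ℚ.∣ t i * t i ∣        ≡⟨ ℚ.0≤p⇒∣p∣≡p (0≤p*p (t i)) ⟩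
    t i * t i              ≤⟨ t²≤s i ⟩
    s i                    ≤⟨ p≤∣p∣ (s i) ⟩
    ℚ.∣ s i ∣              <⟨ small N≤i ⟩
    ε * ε                  ∎)
  where
  open ℚ.≤-Reasoning
  instance
    ε-pos : ℚ.Positive ε
    ε-pos = ℚ.positive 0<ε

-- Positive semidefiniteness of A + r I

module _ {n} {Γ : FiniteGraph n} {a p r} (G : LocalGrid Γ a p r) where
  open FiniteGraph Γ
  open LocalGrid G

  line-meet : ∀ {x u j j′} → u ≢ x → u ∈ line G x j → u ∈ line G x j′ → j ≡ j′
  line-meet u≢x u∈ u∈′ with Equivalence.to (∈-line G) u∈
  ... | inj₁ refl           = contradiction refl u≢x
  ... | inj₂ (_ , _ , refl) = nb∈line⇒≡ G u∈′

  lines-through : ∀ z x → ∑[ j < r ] ind (z ∈? line G x j) ≡ ind (z ≟ᶠ x) ℕ.* r ℕ.+ ind (z ~? x)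
  lines-through z x with z ≟ᶠ x | z ~? x
  ... | yes refl | yes z~z = contradiction z~z (~-irrefl refl)
  ... | yes refl | no _    = trans (∑-const r 1 λ j → ind-true (z ∈? line G z j) (base∈line G))
          (trans (ℕ.*-comm r 1) (sym (ℕ.+-identityʳ _)))
  ... | no z≢x   | no ¬z~x = ∑-zero r λ j → ind-false (z ∈? line G x j) λ z∈ →
          ¬z~x (line-clique G x j z∈ (base∈line G) z≢x)
  ... | no z≢x   | yes z~x with nb-sur (~-sym z~x)
  ...   | i , j , k , refl = trans
          (∑-single _ j λ j′ j′≢j → ind-false (z ∈? line G x j′) (j′≢j ∘ sym ∘ nb∈line⇒≡ G))
          (ind-true (z ∈? line G x j) (nb∈line G))

  -- This is the (z , w) entry of (p a + 1) N Nᵀ for the incidence matrix N of vertices and lines.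
  -- Lines have no canonical index; indexing them by flags repeats each line once for each of its p
  -- a + 1 points.
  flags : Fin n → Fin n → ℕ
  flags z w = ∑[ x < n ] ∑[ j < r ] (ind (z ∈? line G x j) ℕ.* ind (w ∈? line G x j))

  -- The line through an edge z w has p * a + 1 points, while each of the r lines through z
  -- is counted once for each of its points.
  flags-count : ∀ z w → flags z w ≡ suc (p ℕ.* a) ℕ.* (ind (z ~? w) ℕ.+ r ℕ.* ind (z ≟ᶠ w))
  flags-count z w with z ≟ᶠ w
  ... | yes refl = begin
    ∑[ x < n ] ∑[ j < r ] (ind (z ∈? line G x j) ℕ.* ind (z ∈? line G x j))
      ≡⟨ sum-cong-≗ (λ x → trans (sum-cong-≗ λ j → idem (z ∈? line G x j)) (lines-through z x)) ⟩
    ∑[ x < n ] (ind (z ≟ᶠ x) ℕ.* r ℕ.+ ind (z ~? x))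
      ≡⟨ ∑-distrib-+ (λ x → ind (z ≟ᶠ x) ℕ.* r) (λ x → ind (z ~? x)) ⟩
    ∑[ x < n ] (ind (z ≟ᶠ x) ℕ.* r) ℕ.+ ∑[ x < n ] ind (z ~? x)
      ≡⟨ cong₂ ℕ._+_ (∑-δ z λ _ → r) valency ⟩
    r ℕ.+ p ℕ.* (r ℕ.* a)
      ≡⟨ cong (r ℕ.+_) (trans (cong (p ℕ.*_) (ℕ.*-comm r a)) (sym (ℕ.*-assoc p a r))) ⟩
    suc (p ℕ.* a) ℕ.* r
      ≡⟨ cong (suc (p ℕ.* a) ℕ.*_) (cong₂ ℕ._+_ (ind-false (z ~? z) (~-irrefl refl)) (ℕ.*-identityʳ r)) ⟨
    suc (p ℕ.* a) ℕ.* (ind (z ~? z) ℕ.+ r ℕ.* 1) ∎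
    where
    open ≡-Reasoning
    idem : {P : Set} (d : Dec P) → ind d ℕ.* ind d ≡ ind d
    idem (yes _) = refl
    idem (no _)  = refl
    valency : ∑[ x < n ] ind (z ~? x) ≡ p ℕ.* (r ℕ.* a)
    valency = begin
      ∑[ x < n ] ind (z ~? x)                  ≡⟨ sum-cong-≗ (λ x → ℕ.*-identityʳ (ind (z ~? x))) ⟨
      ∑[ x < n ] (ind (z ~? x) ℕ.* 1)          ≡⟨ nb-∑ G z (λ _ → 1) ⟩
      ∑[ i < p ] ∑[ j < r ] ∑[ k < a ] 1
        ≡⟨ ∑-const p _ (λ _ → ∑-const r _ λ _ → trans (∑-const a 1 λ _ → refl) (ℕ.*-identityʳ a)) ⟩
      p ℕ.* (r ℕ.* a)                          ∎
  ... | no z≢w with z ~? w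
  ...   | no ¬z~w = trans
    (∑-zero n λ x → ∑-zero r λ j → trans (sym (ind-× (z ∈? line G x j) (w ∈? line G x j)))
      (ind-false ((z ∈? line G x j) ×-dec (w ∈? line G x j))
        λ (z∈ , w∈) → ¬z~w (line-clique G x j z∈ w∈ z≢w)))
    (sym (trans (cong (suc (p ℕ.* a) ℕ.*_) (ℕ.*-zeroʳ r)) (ℕ.*-zeroʳ (suc (p ℕ.* a)))))
  ...   | yes z~w with nb-sur z~w
  ...     | i , j₀ , k , refl = begin
    ∑[ x < n ] ∑[ j < r ] (ind (z ∈? line G x j) ℕ.* ind (w ∈? line G x j))
      ≡⟨ sum-cong-≗ (λ x → at x (x ∈? line G z j₀)) ⟩
    ∑[ x < n ] ind (x ∈? line G z j₀)
      ≡⟨ ∣∣≡∑ (line G z j₀) ⟨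
    ∣ line G z j₀ ∣
      ≡⟨ ∣line∣ G z j₀ ⟩
    suc (p ℕ.* a)
      ≡⟨ ℕ.*-identityʳ _ ⟨
    suc (p ℕ.* a) ℕ.* 1
      ≡⟨ cong (λ t → suc (p ℕ.* a) ℕ.* suc t) (ℕ.*-zeroʳ r) ⟨
    suc (p ℕ.* a) ℕ.* (1 ℕ.+ r ℕ.* 0) ∎
    where
    open ≡-Reasoning
    both? : ∀ x j → Dec (z ∈ line G x j × w ∈ line G x j)
    both? x j = (z ∈? line G x j) ×-dec (w ∈? line G x j)
    to-ind : ∀ x j → ind (z ∈? line G x j) ℕ.* ind (w ∈? line G x j) ≡ ind (both? x j)
    to-ind x j = sym (ind-× (z ∈? line G x j) (w ∈? line G x j))
    -- For an edge z w, a vertex x on the line z w has exactly one flag whose line contains both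
    -- ends; any other x has none.
    at : ∀ x (d : Dec (x ∈ line G z j₀)) →
         ∑[ j < r ] (ind (z ∈? line G x j) ℕ.* ind (w ∈? line G x j)) ≡ ind d
    at x (no x∉) = ∑-zero r λ j → trans (to-ind x j) (ind-false (both? x j) λ (z∈ , w∈) →
      let j′ , same = line-rebase G z∈
      in x∉ (subst (x ∈_) (trans same (cong (line G z) (sym (nb∈line⇒≡ G (subst (w ∈_) same w∈))))) (base∈line G)))
    at x (yes x∈) with line-rebase G x∈
    ... | j′ , same = trans
      (∑-single _ j′ λ j j≢j′ → trans (to-ind x j) (ind-false (both? x j) λ (z∈ , w∈) → j≢j′ (unique z∈ w∈)))
      (trans (to-ind x j′) (ind-true (both? x j′) (z∈′ , w∈′)))
      where
      z∈′ : z ∈ line G x j′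
      z∈′ = subst (z ∈_) same (base∈line G)
      w∈′ : w ∈ line G x j′
      w∈′ = subst (w ∈_) same (nb∈line G)
      unique : ∀ {j} → z ∈ line G x j → w ∈ line G x j → j ≡ j′
      -- At least one of z and w differs from x, and that one determines the line through x.
      unique z∈ w∈ with z ≟ᶠ x
      ... | no z≢x   = line-meet z≢x z∈ z∈′
      ... | yes refl = line-meet (z≢w ∘ sym) w∈ w∈′

module _ {n} (Γ : FiniteGraph n) where
  open FiniteGraph Γ

  adjacency : (Fin n → ℚ) → Fin n → ℚ
  adjacency v z = ℚΣ.∑[ w < n ] (fromℕ (ind (z ~? w)) * v w)

∥_∥² : ∀ {n} → (Fin n → ℚ) → ℚ
∥ v ∥² = ℚΣ.sum λ z → v z * v z

∑-∑-comm : ∀ {l m n} (f : Fin l → Fin m → Fin n → ℚ) →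
  ℚΣ.∑[ x < l ] ℚΣ.∑[ j < m ] ℚΣ.∑[ z < n ] f x j z ≡
  ℚΣ.∑[ z < n ] ℚΣ.∑[ x < l ] ℚΣ.∑[ j < m ] f x j z
∑-∑-comm f = trans (ℚΣ.sum-cong-≗ λ x → ℚΣ.∑-comm (f x)) (ℚΣ.∑-comm λ x z → ℚΣ.sum λ j → f x j z)

∑-square : ∀ {n} (f : Fin n → ℚ) → ℚΣ.sum f * ℚΣ.sum f ≡ ℚΣ.∑[ z < n ] ℚΣ.∑[ w < n ] (f z * f w)
∑-square f = trans (ℚΣ.*-distribʳ-sum (ℚΣ.sum f) f) (ℚΣ.sum-cong-≗ λ z → ℚΣ.*-distribˡ-sum (f z) f)

∑-δℚ : ∀ {n} (z : Fin n) (v : Fin n → ℚ) → ℚΣ.∑[ w < n ] (fromℕ (ind (z ≟ᶠ w)) * v w) ≡ v z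
∑-δℚ {suc n} zero v = begin
  1ℚ * v zero + ℚΣ.∑[ w < n ] (0ℚ * v (suc w))
    ≡⟨ cong₂ _+_ (ℚ.*-identityˡ (v zero)) (trans (ℚΣ.sum-cong-≗ λ w → ℚ.*-zeroˡ (v (suc w))) (ℚΣ.sum-replicate-zero n)) ⟩
  v zero + 0ℚ
    ≡⟨ ℚ.+-identityʳ (v zero) ⟩
  v zero ∎
  where open ≡-Reasoning
∑-δℚ {suc n} (suc z) v = begin
  0ℚ * v zero + ℚΣ.∑[ w < n ] (fromℕ (ind (suc z ≟ᶠ suc w)) * v (suc w))
    ≡⟨ cong₂ _+_ (ℚ.*-zeroˡ (v zero)) (∑-δℚ z (v ∘ suc)) ⟩
  0ℚ + v (suc z)
    ≡⟨ ℚ.+-identityˡ (v (suc z)) ⟩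
  v (suc z) ∎
  where open ≡-Reasoning

module _ {n} {Γ : FiniteGraph n} {a p r} (G : LocalGrid Γ a p r) where
  open FiniteGraph Γ

  -- Up to the factor p * a + 1, the form A + r I is the sum over all flags of the squared
  -- line sums of v.
  form-nonNeg : ∀ v → 0ℚ ℚ.≤ ℚΣ.∑[ z < n ] (v z * adjacency Γ v z) + fromℕ r * ∥ v ∥²
  form-nonNeg v = ℚ.*-cancelˡ-≤-pos c {{ℚ.positive (fromℕ-mono-< {0} {suc (p ℕ.* a)} ℕ.z<s)}}
    (subst₂ ℚ._≤_ (sym (ℚ.*-zeroʳ c)) expand
      (∑-nonNeg λ x → ∑-nonNeg λ j → 0≤p*p (ℚΣ.sum (on x j))))
    where
    open ≡-Reasoning
    open ℚSolver.+-*-Solver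
    c : ℚ
    c = fromℕ (suc (p ℕ.* a))
    χ : Fin n → Fin r → Fin n → ℕ
    χ x j z = ind (z ∈? line G x j)
    on : Fin n → Fin r → Fin n → ℚ
    on x j z = fromℕ (χ x j z) * v z
    adj I : Fin n → Fin n → ℕ
    adj z w = ind (z ~? w)
    I z w = ind (z ≟ᶠ w)
    weight : ∀ z w → fromℕ (flags G z w) ≡ c * (fromℕ (adj z w) + fromℕ r * fromℕ (I z w))
    weight z w = begin
      fromℕ (flags G z w)                              ≡⟨ cong fromℕ (flags-count G z w) ⟩
      fromℕ (suc (p ℕ.* a) ℕ.* (adj z w ℕ.+ r ℕ.* I z w)) ≡⟨ fromℕ-* (suc (p ℕ.* a)) (adj z w ℕ.+ r ℕ.* I z w) ⟩
      c * fromℕ (adj z w ℕ.+ r ℕ.* I z w)                ≡⟨ cong (c *_) (trans (fromℕ-+ (adj z w) (r ℕ.* I z w)) (cong (fromℕ (adj z w) +_) (fromℕ-* r (I z w)))) ⟩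
      c * (fromℕ (adj z w) + fromℕ r * fromℕ (I z w))    ∎
    collect : ∀ z w → ℚΣ.∑[ x < n ] ℚΣ.∑[ j < r ] (on x j z * on x j w) ≡ fromℕ (flags G z w) * (v z * v w)
    collect z w = begin
      ℚΣ.∑[ x < n ] ℚΣ.∑[ j < r ] (on x j z * on x j w)
        ≡⟨ ℚΣ.sum-cong-≗ (λ x → ℚΣ.sum-cong-≗ λ j → trans
             (solve 4 (λ s t y u → (s :* y) :* (t :* u) := (s :* t) :* (y :* u)) refl
               (fromℕ (χ x j z)) (fromℕ (χ x j w)) (v z) (v w))
             (cong (_* (v z * v w)) (sym (fromℕ-* (χ x j z) (χ x j w))))) ⟩
      ℚΣ.∑[ x < n ] ℚΣ.∑[ j < r ] (fromℕ (χ x j z ℕ.* χ x j w) * (v z * v w))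
        ≡⟨ ℚΣ.sum-cong-≗ (λ x → trans
             (sym (ℚΣ.*-distribʳ-sum (v z * v w) (λ j → fromℕ (χ x j z ℕ.* χ x j w))))
             (cong (_* (v z * v w)) (sym (fromℕ-∑ λ j → χ x j z ℕ.* χ x j w)))) ⟩
      ℚΣ.∑[ x < n ] (fromℕ (∑[ j < r ] (χ x j z ℕ.* χ x j w)) * (v z * v w))
        ≡⟨ ℚΣ.*-distribʳ-sum (v z * v w) (λ x → fromℕ (∑[ j < r ] (χ x j z ℕ.* χ x j w))) ⟨
      ℚΣ.∑[ x < n ] fromℕ (∑[ j < r ] (χ x j z ℕ.* χ x j w)) * (v z * v w)
        ≡⟨ cong (_* (v z * v w)) (fromℕ-∑ λ x → ∑[ j < r ] (χ x j z ℕ.* χ x j w)) ⟨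
      fromℕ (flags G z w) * (v z * v w) ∎
    row : ∀ z → ℚΣ.∑[ w < n ] (fromℕ (flags G z w) * (v z * v w)) ≡ c * (v z * adjacency Γ v z + fromℕ r * (v z * v z))
    row z = begin
      ℚΣ.∑[ w < n ] (fromℕ (flags G z w) * (v z * v w))
        ≡⟨ ℚΣ.sum-cong-≗ (λ w → trans (cong (_* (v z * v w)) (weight z w))
             (solve 6 (λ c s ρ t y u → (c :* (s :+ ρ :* t)) :* (y :* u) := (c :* y) :* (s :* u) :+ (c :* y :* ρ) :* (t :* u)) refl
               c (fromℕ (adj z w)) (fromℕ r) (fromℕ (I z w)) (v z) (v w))) ⟩
      ℚΣ.∑[ w < n ] ((c * v z) * (fromℕ (adj z w) * v w) + (c * v z * fromℕ r) * (fromℕ (I z w) * v w))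
        ≡⟨ ℚΣ.∑-distrib-+ (λ w → (c * v z) * (fromℕ (adj z w) * v w)) (λ w → (c * v z * fromℕ r) * (fromℕ (I z w) * v w)) ⟩
      ℚΣ.∑[ w < n ] ((c * v z) * (fromℕ (adj z w) * v w)) + ℚΣ.∑[ w < n ] ((c * v z * fromℕ r) * (fromℕ (I z w) * v w))
        ≡⟨ cong₂ _+_ (ℚΣ.*-distribˡ-sum (c * v z) (λ w → fromℕ (adj z w) * v w))
                     (ℚΣ.*-distribˡ-sum (c * v z * fromℕ r) (λ w → fromℕ (I z w) * v w)) ⟨
      (c * v z) * adjacency Γ v z + (c * v z * fromℕ r) * ℚΣ.∑[ w < n ] (fromℕ (I z w) * v w)
        ≡⟨ cong (λ t → (c * v z) * adjacency Γ v z + (c * v z * fromℕ r) * t) (∑-δℚ z v) ⟩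
      (c * v z) * adjacency Γ v z + (c * v z * fromℕ r) * v z
        ≡⟨ solve 4 (λ c y s ρ → (c :* y) :* s :+ (c :* y :* ρ) :* y := c :* (y :* s :+ ρ :* (y :* y))) refl
             c (v z) (adjacency Γ v z) (fromℕ r) ⟩
      c * (v z * adjacency Γ v z + fromℕ r * (v z * v z)) ∎
    expand : ℚΣ.∑[ x < n ] ℚΣ.∑[ j < r ] (ℚΣ.sum (on x j) * ℚΣ.sum (on x j)) ≡
             c * (ℚΣ.∑[ z < n ] (v z * adjacency Γ v z) + fromℕ r * ∥ v ∥²)
    expand = begin
      ℚΣ.∑[ x < n ] ℚΣ.∑[ j < r ] (ℚΣ.sum (on x j) * ℚΣ.sum (on x j))
        ≡⟨ ℚΣ.sum-cong-≗ (λ x → ℚΣ.sum-cong-≗ λ j → ∑-square (on x j)) ⟩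
      ℚΣ.∑[ x < n ] ℚΣ.∑[ j < r ] ℚΣ.∑[ z < n ] ℚΣ.∑[ w < n ] (on x j z * on x j w)
        ≡⟨ ∑-∑-comm (λ x j z → ℚΣ.∑[ w < n ] (on x j z * on x j w)) ⟩
      ℚΣ.∑[ z < n ] ℚΣ.∑[ x < n ] ℚΣ.∑[ j < r ] ℚΣ.∑[ w < n ] (on x j z * on x j w)
        ≡⟨ ℚΣ.sum-cong-≗ (λ z → trans (∑-∑-comm λ x j w → on x j z * on x j w)
             (trans (ℚΣ.sum-cong-≗ (collect z)) (row z))) ⟩
      ℚΣ.∑[ z < n ] (c * (v z * adjacency Γ v z + fromℕ r * (v z * v z)))
        ≡⟨ ℚΣ.*-distribˡ-sum c (λ z → v z * adjacency Γ v z + fromℕ r * (v z * v z)) ⟨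
      c * ℚΣ.∑[ z < n ] (v z * adjacency Γ v z + fromℕ r * (v z * v z))
        ≡⟨ cong (c *_) (trans (ℚΣ.∑-distrib-+ (λ z → v z * adjacency Γ v z) (λ z → fromℕ r * (v z * v z)))
             (cong (ℚΣ.∑[ z < n ] (v z * adjacency Γ v z) +_) (sym (ℚΣ.*-distribˡ-sum (fromℕ r) (λ z → v z * v z))))) ⟩
      c * (ℚΣ.∑[ z < n ] (v z * adjacency Γ v z) + fromℕ r * ∥ v ∥²) ∎

-- Delsarte cliques

∑-seq : ∀ {m} (f : Fin m → ℝ) i → seq (∑ f) i ≡ ℚΣ.sum (λ y → seq (f y) i)
∑-seq {zero}  f i = refl
∑-seq {suc m} f i = cong (seq (f zero) i +_) (∑-seq (f ∘ suc) i)

module _ {n} {Γ : FiniteGraph n} {a p r} (G : LocalGrid Γ a p r) where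
  open FiniteGraph Γ

  A-seq : ∀ x y i → seq (A Γ x y) i ≡ fromℕ (ind (x ~? y))
  A-seq x y i with does (x ~? y)
  ... | true  = refl
  ... | false = refl

  -- The equation (∣C∣ - 1)(- θ) = k and - r ≤ θ bound ∣C∣ - 1 from below by k / r.
  delsarte-size : ∀ {k C m} → k ≡ r ℕ.* (p ℕ.* a) → ∣ C ∣ ≡ suc m → 0 ℕ.< r →
    IsDelsarteClique Γ k C → p ℕ.* a ℕ.≤ m
  delsarte-size {k} {C} {m} k≡ ∣C∣≡ 0<r (_ , θ , ((v , v≢0 , eigen) , _) , size) =
    -- If m < p a, the square of each coordinate is bounded by the squared norm, the norm by the
    -- pairing of v with `residue`, and this pairing tends to 0. So v vanishes, against `v≢0`.
    ℕ.≮⇒≥ λ m<pa → v≢0 (λ x → null-cong (λ i → sym (ℚ.+-identityʳ (seq (v x) i)))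
      (null-√ (λ i → ℚ.≤-trans (term≤∑ (λ z → 0≤p*p (at i z)) x) (norm≤ m<pa i)) null-pairing))
    where
    open ≡-Reasoning
    open ℚSolver.+-*-Solver
    σ κ ρ : ℚ
    σ = fromℕ m
    κ = fromℕ k
    ρ = fromℕ r
    at : ℕ → Fin n → ℚ
    at i z = seq (v z) i
    -- The combination m A v + k v is m (A v - θ v) - v (m (-θ) - k), in which θ cancels. Both
    -- brackets are null, by the eigenvector equation and by the clique equation.
    residue : Fin n → ℕ → ℚ
    residue z i = σ * adjacency Γ (at i) z + κ * at i z
    null-θ : Null (λ i → σ * (ℚ.- seq θ i) - κ)
    null-θ = null-cong (λ i → cong (λ t → t * (ℚ.- seq θ i) - κ) (begin
      fromℕ ∣ C ∣ - 1ℚ      ≡⟨ cong (λ t → fromℕ t - 1ℚ) ∣C∣≡ ⟩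
      fromℕ (suc m) - 1ℚ    ≡⟨ fromℕ-∸ (ℕ.s≤s (ℕ.z≤n {m})) ⟨
      σ                     ∎)) size
    null-eigen : ∀ z → Null (λ i → adjacency Γ (at i) z - seq θ i * at i z)
    null-eigen z = null-cong (λ i → cong (_- seq θ i * at i z) (trans
      (∑-seq (λ y → A Γ z y *ᴿ v y) i)
      (ℚΣ.sum-cong-≗ λ y → cong (_* at i y) (A-seq z y i)))) (eigen z)
    v-bounded : ∀ z → EventuallyBounded (seq (v z))
    v-bounded z = cauchy-bounded (seq (v z)) (cauchy (v z))
    null-residue : ∀ z → Null (residue z)
    null-residue z = null-cong
      (λ i → solve 5 (λ s b t y k → s :* (b :- t :* y) :+ (:- con 1ℚ) :* (y :* (s :* (:- t) :- k)) := s :* b :+ k :* y)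
        refl σ (adjacency Γ (at i) z) (seq θ i) (at i z) κ)
      (null-+ (null-* (const-bounded σ) (null-eigen z))
              (null-* (const-bounded (ℚ.- 1ℚ)) (null-* (v-bounded z) null-θ)))
    null-pairing : Null (λ i → ℚΣ.∑[ z < n ] (at i z * residue z i))
    null-pairing = null-∑ λ z → null-* (v-bounded z) (null-residue z)
    pairing : ∀ i → ℚΣ.∑[ z < n ] (at i z * residue z i) ≡
              σ * ℚΣ.∑[ z < n ] (at i z * adjacency Γ (at i) z) + κ * ∥ at i ∥²
    pairing i = begin
      ℚΣ.∑[ z < n ] (at i z * residue z i)
        ≡⟨ ℚΣ.sum-cong-≗ (λ z → solve 4 (λ y s b k → y :* (s :* b :+ k :* y) := s :* (y :* b) :+ k :* (y :* y))
             refl (at i z) σ (adjacency Γ (at i) z) κ) ⟩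
      ℚΣ.∑[ z < n ] (σ * (at i z * adjacency Γ (at i) z) + κ * (at i z * at i z))
        ≡⟨ ℚΣ.∑-distrib-+ (λ z → σ * (at i z * adjacency Γ (at i) z)) (λ z → κ * (at i z * at i z)) ⟩
      ℚΣ.∑[ z < n ] (σ * (at i z * adjacency Γ (at i) z)) + ℚΣ.∑[ z < n ] (κ * (at i z * at i z))
        ≡⟨ cong₂ _+_ (ℚΣ.*-distribˡ-sum σ (λ z → at i z * adjacency Γ (at i) z))
                     (ℚΣ.*-distribˡ-sum κ (λ z → at i z * at i z)) ⟨
      σ * ℚΣ.∑[ z < n ] (at i z * adjacency Γ (at i) z) + κ * ∥ at i ∥² ∎
    -- With k = m r + τ the pairing is m times the form of A + r I plus τ times the squared norm,
    -- and τ = r (p a - m) is at least 1.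
    norm≤ : m ℕ.< p ℕ.* a → ∀ i → ∥ at i ∥² ℚ.≤ ℚΣ.∑[ z < n ] (at i z * residue z i)
    norm≤ m<pa i = subst₂ ℚ._≤_ (trans (ℚ.+-identityˡ _) (ℚ.*-identityˡ N)) (sym split)
      (ℚ.+-mono-≤ {0ℚ} {σ * (S + ρ * N)} {1ℚ * N} {τ * N}
        (subst (ℚ._≤ σ * (S + ρ * N)) (ℚ.*-zeroʳ σ)
          (ℚ.*-monoˡ-≤-nonNeg σ {{fromℕ-nonNeg m}} (form-nonNeg G (at i))))
        (ℚ.*-monoʳ-≤-nonNeg N {{ℚ.nonNegative (∑-nonNeg λ z → 0≤p*p (at i z))}}
          (fromℕ-mono-≤ (ℕ.*-mono-≤ 0<r (ℕ.m<n⇒0<n∸m m<pa)))))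
      where
      S N τ : ℚ
      S = ℚΣ.∑[ z < n ] (at i z * adjacency Γ (at i) z)
      N = ∥ at i ∥²
      τ = fromℕ (r ℕ.* (p ℕ.* a ∸ m))
      κ≡ : κ ≡ σ * ρ + τ
      κ≡ = begin
        fromℕ k                                           ≡⟨ cong fromℕ k≡ ⟩
        fromℕ (r ℕ.* (p ℕ.* a))                           ≡⟨ cong (λ t → fromℕ (r ℕ.* t)) (ℕ.m+[n∸m]≡n (ℕ.<⇒≤ m<pa)) ⟨
        fromℕ (r ℕ.* (m ℕ.+ (p ℕ.* a ∸ m)))               ≡⟨ cong fromℕ (trans (ℕ.*-distribˡ-+ r m _) (cong (ℕ._+ r ℕ.* (p ℕ.* a ∸ m)) (ℕ.*-comm r m))) ⟩
        fromℕ (m ℕ.* r ℕ.+ r ℕ.* (p ℕ.* a ∸ m))           ≡⟨ fromℕ-+ (m ℕ.* r) _ ⟩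
        fromℕ (m ℕ.* r) + τ                               ≡⟨ cong (_+ τ) (fromℕ-* m r) ⟩
        σ * ρ + τ                                         ∎
      split : ℚΣ.∑[ z < n ] (at i z * residue z i) ≡ σ * (S + ρ * N) + τ * N
      split = begin
        ℚΣ.∑[ z < n ] (at i z * residue z i)   ≡⟨ pairing i ⟩
        σ * S + κ * N                          ≡⟨ cong (λ t → σ * S + t * N) κ≡ ⟩
        σ * S + (σ * ρ + τ) * N                ≡⟨ solve 5 (λ s b q t y → s :* b :+ (s :* q :+ t) :* y := s :* (b :+ q :* y) :+ t :* y) refl σ S ρ τ N ⟩
        σ * (S + ρ * N) + τ * N                ∎

lookup-injective : ∀ {A : Set} {xs : List A} → Unique xs → ∀ i j → List.lookup xs i ≡ List.lookup xs j → i ≡ j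
lookup-injective (_ ∷ _)   zero    zero    eq = refl
lookup-injective (x∉ ∷ _)  zero    (suc j) eq = contradiction eq (All.lookup x∉ (∈-lookup j))
lookup-injective (x∉ ∷ _)  (suc i) zero    eq = contradiction (sym eq) (All.lookup x∉ (∈-lookup i))
lookup-injective (_ ∷ uxs) (suc i) (suc j) eq = cong suc (lookup-injective uxs i j eq)

length-filter-tabulate : ∀ {m} {A : Set} {P : A → Set} (P? : ∀ x → Dec (P x)) (f : Fin m → A) →
  length (filter P? (List.tabulate f)) ≡ ∑[ i < m ] ind (P? (f i))
length-filter-tabulate {zero}  P? f = refl
length-filter-tabulate {suc m} P? f with P? (f zero)
... | yes _ = cong suc (length-filter-tabulate P? (f ∘ suc))
... | no _  = length-filter-tabulate P? (f ∘ suc)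

-- Clique extensions of grids

-- The rows and columns that are not near are scattered over the grid; this relabels them by an
-- initial segment, as the target grid requires.
record Enumeration {m : ℕ} (P : Fin m → Set) (c : ℕ) : Set where
  field
    elem       : Fin c → Fin m
    injective  : ∀ {s t} → elem s ≡ elem t → s ≡ t
    sound      : ∀ s → P (elem s)
    exhaustive : ∀ {i} → P i → ∃[ s ] elem s ≡ i

enumerate : ∀ {m c} {P : Fin m → Set} (P? : ∀ i → Dec (P i)) → ∑[ i < m ] ind (P? i) ≡ c → Enumeration P c
enumerate {m} {P = P} P? count = subst (Enumeration P) (trans (length-filter-tabulate P? (λ i → i)) count) (record
  { elem       = List.lookup (filter P? (allFin m))
  ; injective  = lookup-injective (filter⁺ P? (allFin⁺ m)) _ _
  ; sound      = λ s → proj₂ (∈-filter⁻ P? {xs = allFin m} (∈-lookup s))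
  ; exhaustive = λ {i} Pi → let i∈ = ∈-filter⁺ P? (∈-allFin i) Pi in Any.index i∈ , sym (lookup-index i∈)
  })

cell-~⇒line : ∀ {p r a} {i i′ : Fin p} {j j′ : Fin r} {k k′ : Fin a} →
  Graph._~_ (cliqueExtension a (grid p r)) ((i , j) , k) ((i′ , j′) , k′) → i ≡ i′ ⊎ j ≡ j′
cell-~⇒line (inj₁ (inj₁ (i≡i′ , _))) = inj₁ i≡i′
cell-~⇒line (inj₁ (inj₂ (_ , j≡j′))) = inj₂ j≡j′
cell-~⇒line (inj₂ (refl , _))        = inj₁ refl

cell-row-~ : ∀ {p r a} (i : Fin p) {j j′ : Fin r} {k k′ : Fin a} → (j ≡ j′ → k ≢ k′) →
  Graph._~_ (cliqueExtension a (grid p r)) ((i , j) , k) ((i , j′) , k′)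
cell-row-~ i {j} {j′} distinct with j ≟ᶠ j′
... | yes refl = inj₂ (refl , distinct refl)
... | no j≢j′  = inj₁ (inj₁ (refl , j≢j′))

cell-column-~ : ∀ {p r a} (j : Fin r) {i i′ : Fin p} {k k′ : Fin a} → (i ≡ i′ → k ≢ k′) →
  Graph._~_ (cliqueExtension a (grid p r)) ((i , j) , k) ((i′ , j) , k′)
cell-column-~ j {i} {i′} distinct with i ≟ᶠ i′
... | yes refl = inj₂ (refl , distinct refl)
... | no i≢i′  = inj₁ (inj₂ (i≢i′ , refl))

∈-irrelevant : ∀ {n} {S : Subset n} {u v : Σ[ z ∈ Fin n ] z ∈ S} → proj₁ u ≡ proj₁ v → u ≡ v
∈-irrelevant {u = _ , z∈} {_ , z∈′} refl = cong (_ ,_) ([]=-irrelevant z∈ z∈′)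

localGrid : ∀ {n} {Γ : FiniteGraph n} {a p r} →
  (∀ x → induced Γ (Sphere Γ 1 x) ≅ cliqueExtension a (grid p r)) →
  0 ℕ.< a → 1 ℕ.< p → 1 ℕ.< r → p ≢ r → LocalGrid Γ a p r
localGrid {n} {Γ} {a} {p} {r} local 0<a 1<p 1<r p≢r = record
  { nb        = λ y i j k → proj₁ (point y i j k)
  ; nb-adj    = λ y i j k → Equivalence.to (distance-1 Γ) (Equivalence.to (∈-sphere Γ) (proj₂ (point y i j k)))
  ; nb-sur    = λ {y} {z} y~z →
      let z′ = z , Equivalence.from (∈-sphere Γ) (Equivalence.from (distance-1 Γ) y~z)
          (i , j) , k = Loc.to y z′
      in i , j , k , cong proj₁ (Inverse.strictlyInverseʳ (Loc.vertices y) z′)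
  ; nb-inj    = λ {y} eq → case cell-injective y eq of λ where refl → refl , refl , refl
  ; nb-line   = λ {y} adj → cell-~⇒line (subst₂ Cell._~_ (back y _ _ _) (back y _ _ _) (Equivalence.to (Loc.adjacent y _ _) adj))
  ; nb-row    = λ y i ≢ → toΓ y (cell-row-~ i λ { refl refl → ≢ refl })
  ; nb-column = λ y j ≢ → toΓ y (cell-column-~ j λ { refl refl → ≢ refl })
  ; 0<a       = 0<a
  ; 1<p       = 1<p
  ; 1<r       = 1<r
  ; p≢r       = p≢r
  }
  where
  open FiniteGraph Γ
  module Loc (y : Fin n) = _≅_ (local y)
  module Cell = Graph (cliqueExtension a (grid p r))
  point : ∀ y → Fin p → Fin r → Fin a → Σ[ z ∈ Fin n ] z ∈ Sphere Γ 1 y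
  point y i j k = Inverse.from (Loc.vertices y) ((i , j) , k)
  back : ∀ y i j k → Loc.to y (point y i j k) ≡ ((i , j) , k)
  back y i j k = Inverse.strictlyInverseˡ (Loc.vertices y) ((i , j) , k)
  cell-injective : ∀ y {i j k i′ j′ k′} → proj₁ (point y i j k) ≡ proj₁ (point y i′ j′ k′) →
    ((i , j) , k) ≡ ((i′ , j′) , k′)
  cell-injective y eq = trans (sym (back y _ _ _)) (trans (cong (Loc.to y) (∈-irrelevant eq)) (back y _ _ _))
  toΓ : ∀ y {i j k i′ j′ k′} → ((i , j) , k) Cell.~ ((i′ , j′) , k′) →
    proj₁ (point y i j k) ~ proj₁ (point y i′ j′ k′)
  toΓ y adj = Equivalence.from (Loc.adjacent y _ _) (subst₂ Cell._~_ (sym (back y _ _ _)) (sym (back y _ _ _)) adj)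

module _ {n} {Γ : FiniteGraph n} {a p r} (G : LocalGrid Γ a p r) where
  open FiniteGraph Γ
  open LocalGrid G

  -- Adjacency between distinct neighbours of y depends only on sharing a row or a column, so a set
  -- made of all the cells over chosen rows and columns is again a clique extension of a grid.
  subgrid : ∀ {y p′ r′} {P : Fin p → Set} {R : Fin r → Set} {S : Subset n} →
    Enumeration P p′ → Enumeration R r′ → (∀ {z} → z ∈ S → y ~ z) →
    (∀ {i j k} → P i → R j → nb y i j k ∈ S) → (∀ {i j k} → nb y i j k ∈ S → P i × R j) →
    induced Γ S ≅ cliqueExtension a (grid p′ r′)
  subgrid {y} {p′} {r′} {S = S} rows columns adj nb∈S nb∈S⁻ = record
    { vertices = ↔-sym cells
    ; adjacent = λ u v → let s = Inverse.from cells u ; t = Inverse.from cells v in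
        subst₂ (λ u v → proj₁ u ~ proj₁ v ⇔ s Cell.~ t)
          (Inverse.strictlyInverseˡ cells u) (Inverse.strictlyInverseˡ cells v) (point-~ s t)
    }
    where
    module Row = Enumeration rows
    module Column = Enumeration columns
    module Cell = Graph (cliqueExtension a (grid p′ r′))
    Cells Points : Set
    Cells = (Fin p′ × Fin r′) × Fin a
    Points = Σ[ z ∈ Fin n ] z ∈ S
    vertex : Cells → Fin n
    vertex ((i , j) , k) = nb y (Row.elem i) (Column.elem j) k
    point : Cells → Points
    point s@((i , j) , k) = vertex s , nb∈S (Row.sound i) (Column.sound j)
    point-injective : ∀ {s t} → point s ≡ point t → s ≡ t
    point-injective eq with nb-inj (cong proj₁ eq)
    ... | ri , cj , refl = cong₂ (λ i j → (i , j) , _) (Row.injective ri) (Column.injective cj)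
    point-surjective : ∀ u → ∃[ s ] point s ≡ u
    point-surjective (z , z∈) with nb-sur (adj z∈)
    ... | i , j , k , refl =
      let Pi , Rj = nb∈S⁻ z∈
          s , rs≡ = Row.exhaustive Pi
          t , ct≡ = Column.exhaustive Rj
      in ((s , t) , k) , ∈-irrelevant (cong₂ (λ i j → nb y i j k) rs≡ ct≡)
    cells : Cells ↔ Points
    cells = ⤖⇒↔ (mk⤖ (point-injective , λ u → let s , eq = point-surjective u in s , λ where refl → eq))
    point-~ : ∀ s t → vertex s ~ vertex t ⇔ s Cell.~ t
    point-~ s@((i , j) , k) t@((i′ , j′) , k′) = mk⇔
      (λ s~t → case nb-line s~t of λ where
        (inj₁ ri) → in-row (Row.injective ri) λ { refl refl → ~-irrefl (cong (λ i → nb y i _ _) ri) s~t }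
        (inj₂ cj) → in-column (Column.injective cj) λ { refl refl → ~-irrefl (cong (λ j → nb y _ j _) cj) s~t })
      λ where
        (inj₁ (inj₁ (refl , j≢j′))) → nb-row y (Row.elem i) (j≢j′ ∘ Column.injective ∘ proj₁ ∘ proj₂ ∘ nb-inj)
        (inj₁ (inj₂ (i≢i′ , refl))) → nb-column y (Column.elem j) (i≢i′ ∘ Row.injective ∘ proj₁ ∘ nb-inj)
        (inj₂ (refl , k≢k′))        → nb-row y (Row.elem i) (k≢k′ ∘ proj₂ ∘ proj₂ ∘ nb-inj)
      where
      in-row : i ≡ i′ → (j ≡ j′ → k ≢ k′) → s Cell.~ t
      in-row refl = cell-row-~ i
      in-column : j ≡ j′ → (i ≡ i′ → k ≢ k′) → s Cell.~ t
      in-column refl = cell-column-~ j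

module _ {n} {Γ : FiniteGraph n} {a p r g} (G : LocalGrid Γ a p r) (metric : GridMetric Γ a p r g) where
  open FiniteGraph Γ
  open LocalGrid G
  open GridMetric metric

  distance⇒d : ∀ {x y i} → Distance Γ x y i → d x y ≡ i
  distance⇒d = distance-unique Γ (distance _ _)

  d⇒distance : ∀ {x y i} → d x y ≡ i → Distance Γ x y i
  d⇒distance {x} {y} = λ { refl → distance x y }

  ∈-sphere-d : ∀ {x y i} → y ∈ Sphere Γ i x ⇔ d x y ≡ i
  ∈-sphere-d = mk⇔ (distance⇒d ∘ Equivalence.to (∈-sphere Γ)) (Equivalence.from (∈-sphere Γ) ∘ d⇒distance)

  -- Neighbours on near lines stay within distance h, and `farCells` puts all others at distance h +
  -- 1; so exactly the `g h` near rows and `g h` near columns are deleted.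
  far-neighbours : ∀ {x y h} → d x y ≡ h →
    induced Γ (Sphere Γ (suc h) x ∩ Sphere Γ 1 y) ≅ cliqueExtension a (grid (p ∸ g h) (r ∸ g h))
  far-neighbours {x} {y} {h} dxy≡ = subgrid G
    (enumerate (λ i → ¬? (near? metric T x y i)) (trans (∑-ind-¬ (near? metric T x y)) (cong (p ∸_) (nearT dxy≡))))
    (enumerate (λ j → ¬? (near? metric G x y j)) (trans (∑-ind-¬ (near? metric G x y)) (cong (r ∸_) (nearG dxy≡))))
    (Equivalence.to (distance-1 Γ) ∘ Equivalence.to (∈-sphere Γ) ∘ proj₂ ∘ x∈p∩q⁻ (Sphere Γ (suc h) x) (Sphere Γ 1 y))
    (λ {i} {j} {k} ¬nearT ¬nearG → x∈p∩q⁺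
      ( Equivalence.from ∈-sphere-d (farCells metric G nearG nearT dxy≡ i j k ¬nearT ¬nearG)
      , Equivalence.from (∈-sphere Γ) (Equivalence.from (distance-1 Γ) (nb-adj y i j k))))
    (λ {i} {j} {k} nb∈ →
      let far = Equivalence.to ∈-sphere-d (proj₁ (x∈p∩q⁻ (Sphere Γ (suc h) x) (Sphere Γ 1 y) nb∈))
      in (λ near → too-far far (near⇒≤ metric T near j k)) , (λ near → too-far far (near⇒≤ metric G near i k)))
    where
    T : LocalGrid Γ a r p
    T = transpose G
    nearG : NearCount metric G h
    nearG = proj₁ (proj₁ (counts metric G h))
    nearT : NearCount metric T h
    nearT = proj₂ (proj₁ (counts metric G h))
    too-far : ∀ {z} → d x z ≡ suc h → ¬ d x z ℕ.≤ d x y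
    too-far far ≤y = ℕ.1+n≰n (subst₂ ℕ._≤_ far dxy≡ ≤y)

x∈p⇒∣p∣≡suc : ∀ {n} {S : Subset n} {x} → x ∈ S → ∃[ m ] ∣ S ∣ ≡ suc m
x∈p⇒∣p∣≡suc {S = true ∷ S}  here        = ∣ S ∣ , refl
x∈p⇒∣p∣≡suc {S = true ∷ S}  (there x∈S) = ∣ S ∣ , refl
x∈p⇒∣p∣≡suc {S = false ∷ S} (there x∈S) = x∈p⇒∣p∣≡suc x∈S

-- Assemblies

-- The interface to the spectral part: eigenvalues enter only through the bound `large`. Its vertex
-- x makes C nonempty, so that ∣C∣ - 1 is a natural number.
record CliqueCover {n : ℕ} (Γ : FiniteGraph n) (l : ℕ) (𝒞 : Pred (Subset n) 0ℓ) : Set where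
  open FiniteGraph Γ
  field
    clique : ∀ {C} → C ∈ᴾ 𝒞 → IsClique Γ C
    large  : ∀ {C x} → C ∈ᴾ 𝒞 → x ∈ C → l ℕ.≤ ∣ C ∣
    covers : ∀ {x y} → x ~ y → ∃[ C ] (C ∈ᴾ 𝒞 × x ∈ C × y ∈ C)

delsarteCover : ∀ {n} {Γ : FiniteGraph n} {a p r k} {𝒞 : Pred (Subset n) 0ℓ} → LocalGrid Γ a p r →
  k ≡ r ℕ.* (p ℕ.* a) → IsGeometric Γ k 𝒞 → CliqueCover Γ (suc (p ℕ.* a)) 𝒞
delsarteCover G k≡ (delsarte , edge) = record
  { clique = λ C∈𝒞 → proj₁ (delsarte C∈𝒞)
  ; large  = λ C∈𝒞 x∈C → let m , ∣C∣≡ = x∈p⇒∣p∣≡suc x∈C in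
      subst (_ ℕ.≤_) (sym ∣C∣≡)
        (ℕ.s≤s (delsarte-size G k≡ ∣C∣≡ (ℕ.<-trans ℕ.z<s (LocalGrid.1<r G)) (delsarte C∈𝒞)))
  ; covers = λ x~y → let C , C∋ , _ = edge x~y in C , C∋
  }

module _ {n} {Γ : FiniteGraph n} {a p r} (G : LocalGrid Γ a p r) (r<p : r ℕ.< p)
  {𝒞 : Pred (Subset n) 0ℓ} (cover : CliqueCover Γ (suc (p ℕ.* a)) 𝒞) where
  open FiniteGraph Γ
  open LocalGrid G
  open CliqueCover cover

  private
    T : LocalGrid Γ a r p
    T = transpose G

    some : ∀ {m l} → l ℕ.< m → Fin m
    some {suc m} _ = zero

  ∣short∣<∣long∣ : ∀ {y i} → ∣ line T y i ∣ ℕ.< suc (p ℕ.* a)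
  ∣short∣<∣long∣ {y} {i} = subst (ℕ._< suc (p ℕ.* a)) (sym (∣line∣ T y i))
    (ℕ.s<s (ℕ.*-monoˡ-< a {{ℕ.>-nonZero 0<a}} r<p))

  -- Take an edge of the long line and the member of `𝒞` covering it. That clique is too large for a
  -- short line, so it lies in the long line, and by its size it fills it.
  long∈𝒞 : ∀ y j → line G y j ∈ᴾ 𝒞
  long∈𝒞 y j with covers (nb-adj y (some 1<p) j (some 0<a))
  ... | C , C∈𝒞 , y∈C , z∈C with clique⊆line G (clique C∈𝒞) y∈C
  ...   | inj₁ (j′ , C⊆) with nb∈line⇒≡ G (C⊆ z∈C)
  ...     | refl = subst 𝒞 (⊆∧∣∣≤⇒≡ C⊆ (subst (ℕ._≤ ∣ C ∣) (sym (∣line∣ G y j)) (large C∈𝒞 y∈C))) C∈𝒞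
  long∈𝒞 y j | C , C∈𝒞 , y∈C , z∈C | inj₂ (i , C⊆) =
    contradiction (ℕ.≤-trans (large C∈𝒞 y∈C) (p⊆q⇒∣p∣≤∣q∣ C⊆)) (ℕ.<⇒≱ ∣short∣<∣long∣)

  -- A maximal clique through y is a line at y. The long ones belong to `𝒞`, and the short ones are
  -- too small to belong to it.
  assembly⇔short : ∀ {M y} → (IsAssembly Γ 𝒞 M × y ∈ M) ⇔ (∃[ i ] M ≡ line T y i)
  assembly⇔short {M} {y} = mk⇔
    (λ ((maximal , M∉𝒞) , y∈M) → case maximal-clique G maximal y∈M of λ where
      (inj₁ (j , refl)) → contradiction (long∈𝒞 y j) M∉𝒞
      (inj₂ short)      → short)
    λ where (i , refl) → (line-maximal T y i , λ short∈𝒞 →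
                           contradiction (large short∈𝒞 (base∈line T)) (ℕ.<⇒≱ ∣short∣<∣long∣))
                         , base∈line T

  module _ {g} (metric : GridMetric Γ a p r g) where
    open GridMetric metric

    -- With a vertex of M nearest to x as base point, M is a short line meeting the hypotheses of
    -- `LineCount`.
    assembly-count : ∀ {M x i} → IsAssembly Γ 𝒞 M → DistanceToSet Γ x M i →
      ∣ M ∩ Sphere Γ i x ∣ ≡ suc (g i ℕ.* a)
    assembly-count {x = x} {i} assembly ((y , y∈M , x→y) , beyond)
      with Equivalence.to assembly⇔short (assembly , y∈M)
    ... | k , refl = begin
      ∣ line T y k ∩ Sphere Γ i x ∣
        ≡⟨ ∣∩∣≡∑ (line T y k) (Sphere Γ i x) ⟩
      ∑[ z < n ] (ind (z ∈? line T y k) ℕ.* ind (z ∈? Sphere Γ i x))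
        ≡⟨ sum-cong-≗ (λ z → cong (ind (z ∈? line T y k) ℕ.*_)
             (ind-cong (z ∈? Sphere Γ i x) (d x z ℕ.≟ i) (∈-sphere-d G metric))) ⟩
      ∑[ z < n ] (ind (z ∈? line T y k) ℕ.* ind (d x z ℕ.≟ i))
        ≡⟨ proj₂ (proj₂ (counts metric G i)) (distance⇒d G metric x→y) (λ z∈ → beyond z∈ (distance x _)) ⟩
      suc (g i ℕ.* a) ∎
      where open ≡-Reasoning

    -- Each point of a line through y is within one step of y, hence at distance at least h from x;
    -- a single point at distance h therefore settles the distance to the line.
    near⇔atDistance : ∀ {x y i h} → d x y ≡ suc h → Near metric T x y i ⇔ DistanceToSet Γ x (line T y i) h
    near⇔atDistance {x} {y} {i} {h} dxy≡ = mk⇔ to′ from′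
      where
      to′ : Near metric T x y i → DistanceToSet Γ x (line T y i) h
      to′ (j , k , eq) =
        (_ , nb∈line T {i = j} {k = k} , d⇒distance G metric (ℕ.suc-injective (trans eq dxy≡))) ,
        λ z∈ x→z → ℕ.s≤s⁻¹ (subst₂ (λ s t → s ℕ.≤ suc t) dxy≡ (distance⇒d G metric x→z) (line-≥ metric T z∈))
      from′ : DistanceToSet Γ x (line T y i) h → Near metric T x y i
      from′ ((z , z∈ , x→z) , _) with Equivalence.to (∈-line T) z∈
      ... | inj₁ refl           = contradiction (trans (sym dxy≡) (distance⇒d G metric x→z)) ℕ.1+n≢n
      ... | inj₂ (j , k , refl) = j , k , trans (cong suc (distance⇒d G metric x→z)) (sym dxy≡)

    nearAssemblies : ∀ {x y h} → d x y ≡ suc h →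
      HasCount (λ M → IsAssembly Γ 𝒞 M × y ∈ M × DistanceToSet Γ x M h) (fromℕ (g (suc h)))
    nearAssemblies {x} {y} {h} dxy≡ = List.map (line T y) near , map⁺ line-injective (filter⁺ P? (allFin⁺ p)) ,
      (λ M → mk⇔ sound complete) ,
      cong fromℕ (trans (length-map (line T y) near) (trans (length-filter-tabulate P? (λ i → i))
        (proj₂ (proj₁ (counts metric G (suc h))) dxy≡)))
      where
      P? : ∀ i → Dec (Near metric T x y i)
      P? = near? metric T x y
      j₀ : Fin r
      j₀ = some 1<r
      k₀ : Fin a
      k₀ = some 0<a
      near : List (Fin p)
      near = filter P? (allFin p)
      line-injective : ∀ {i i′} → line T y i ≡ line T y i′ → i ≡ i′
      line-injective {i} eq = nb∈line⇒≡ T (subst (nb y i j₀ k₀ ∈_) eq (nb∈line T))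
      sound : ∀ {M} → M List.∈ List.map (line T y) near → IsAssembly Γ 𝒞 M × y ∈ M × DistanceToSet Γ x M h
      sound M∈ with ∈-map⁻ (line T y) M∈
      ... | i , i∈ , refl =
        let assembly , y∈M = Equivalence.from assembly⇔short (i , refl)
        in assembly , y∈M , Equivalence.to (near⇔atDistance dxy≡) (proj₂ (∈-filter⁻ P? {xs = allFin p} i∈))
      complete : ∀ {M} → IsAssembly Γ 𝒞 M × y ∈ M × DistanceToSet Γ x M h → M List.∈ List.map (line T y) near
      complete (assembly , y∈M , at) with Equivalence.to assembly⇔short (assembly , y∈M)
      ... | i , refl = ∈-map⁺ (line T y) (∈-filter⁺ P? (∈-allFin i) (Equivalence.from (near⇔atDistance dxy≡) at))

-- Classical parameters

-- The bracket [j] for natural b, by the recursion [j + 1] = 1 + b [j], which makes it integral and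
-- monotone without division.
gauss : ℕ → ℕ → ℕ
gauss b zero    = 0
gauss b (suc j) = suc (b ℕ.* gauss b j)

gauss-mono-≤ : ∀ b {i j} → i ℕ.≤ j → gauss b i ℕ.≤ gauss b j
gauss-mono-≤ b ℕ.z≤n       = ℕ.z≤n
gauss-mono-≤ b (ℕ.s≤s i≤j) = ℕ.s≤s (ℕ.*-monoʳ-≤ b (gauss-mono-≤ b i≤j))

bracket≡gauss : ∀ b .{{_ : ℤ.NonZero (ℤ.+ b ℤ.- 1ℤ)}} j → [ ℤ.+ b , j ] ≡ fromℕ (gauss b j)
bracket≡gauss b j = begin
  fromℤ (B ℤ.^ j ℤ.- 1ℤ) ÷ c         ≡⟨ cong (λ t → fromℤ t ÷ c) (geometric-sum j) ⟩
  fromℤ (g j ℤ.* (B ℤ.- 1ℤ)) ÷ c     ≡⟨ cong (_÷ c) (fromℤ-* (g j) (B ℤ.- 1ℤ)) ⟩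
  fromℤ (g j) * c ÷ c                ≡⟨ ℚ.*-assoc (fromℤ (g j)) c (ℚ.1/ c) ⟩
  fromℤ (g j) * (c ÷ c)              ≡⟨ cong (fromℤ (g j) *_) (ℚ.*-inverseʳ c) ⟩
  fromℤ (g j) * 1ℚ                   ≡⟨ ℚ.*-identityʳ (fromℤ (g j)) ⟩
  fromℕ (gauss b j)                  ∎
  where
  open ≡-Reasoning
  open ℤSolver.+-*-Solver
  B : ℤ
  B = ℤ.+ b
  g : ℕ → ℤ
  g j = ℤ.+ gauss b j
  c : ℚ
  c = fromℤ (B ℤ.- 1ℤ)
  geometric-sum : ∀ j → B ℤ.^ j ℤ.- 1ℤ ≡ g j ℤ.* (B ℤ.- 1ℤ)
  geometric-sum zero    = refl
  geometric-sum (suc j) = begin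
    B ℤ.* B ℤ.^ j ℤ.- 1ℤ
      ≡⟨ solve 2 (λ x y → x :* y :- con 1ℤ := x :* (y :- con 1ℤ) :+ (x :- con 1ℤ)) refl B (B ℤ.^ j) ⟩
    B ℤ.* (B ℤ.^ j ℤ.- 1ℤ) ℤ.+ (B ℤ.- 1ℤ)
      ≡⟨ cong (λ t → B ℤ.* t ℤ.+ (B ℤ.- 1ℤ)) (geometric-sum j) ⟩
    B ℤ.* (g j ℤ.* (B ℤ.- 1ℤ)) ℤ.+ (B ℤ.- 1ℤ)
      ≡⟨ solve 2 (λ x y → x :* (y :* (x :- con 1ℤ)) :+ (x :- con 1ℤ) := (con 1ℤ :+ x :* y) :* (x :- con 1ℤ))
           refl B (g j) ⟩
    (1ℤ ℤ.+ B ℤ.* g j) ℤ.* (B ℤ.- 1ℤ)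
      ≡⟨ cong (λ t → (1ℤ ℤ.+ t) ℤ.* (B ℤ.- 1ℤ)) (ℤ.pos-* b (gauss b j)) ⟨
    g (suc j) ℤ.* (B ℤ.- 1ℤ) ∎

-- The formulas for b and c are given only up to D; `HasDiameter` ensures that they cover every
-- distance that occurs.
gridMetric : ∀ {n} (Γ : FiniteGraph n) {D a p b c g} → g 0 ≡ 0 → IsDistanceRegular Γ b c → HasDiameter Γ D →
  (∀ {i} → i ℕ.≤ D → b i ≡ (p ∸ g i) ℕ.* ((g D ∸ g i) ℕ.* a)) →
  (∀ {i} → suc i ℕ.≤ D → c (suc i) ≡ g (suc i) ℕ.* suc (g i ℕ.* a)) →
  GridMetric Γ a p (g D) g
gridMetric {n} Γ {D} g-zero regular (≤D , _) b≡ c≡ = record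
  { d        = d
  ; distance = distance
  ; g-zero   = g-zero
  ; forward  = λ x y → trans (sphere-∑ _) (trans (b-count (distance x y)) (b≡ (≤D (distance x y))))
  ; backward = λ {x} {y} {h} dxy≡ → let x→y = subst (Distance Γ x y) dxy≡ (distance x y) in
      trans (sphere-∑ h) (trans (c-count x→y) (c≡ (≤D x→y)))
  }
  where
  open FiniteGraph Γ
  open IsDistanceRegular regular
  d : Fin n → Fin n → ℕ
  d x y = proj₁ (distance-exists Γ connected x y)
  distance : ∀ x y → Distance Γ x y (d x y)
  distance x y = proj₂ (distance-exists Γ connected x y)
  sphere-∑ : ∀ {x y} i → ∑[ z < n ] (ind (y ~? z) ℕ.* ind (d x z ℕ.≟ i)) ≡ ∣ Sphere Γ i x ∩ Sphere Γ 1 y ∣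
  sphere-∑ {x} {y} i = sym (trans (∣∩∣≡∑ (Sphere Γ i x) (Sphere Γ 1 y)) (sum-cong-≗ λ z → trans
    (ℕ.*-comm (ind (z ∈? Sphere Γ i x)) (ind (z ∈? Sphere Γ 1 y)))
    (cong₂ ℕ._*_
      (ind-cong (z ∈? Sphere Γ 1 y) (y ~? z) (distance-1 Γ ⇔-∘ ∈-sphere Γ))
      (ind-cong (z ∈? Sphere Γ i x) (d x z ℕ.≟ i) (mk⇔
        (distance-unique Γ (distance x z) ∘ Equivalence.to (∈-sphere Γ))
        λ where refl → Equivalence.from (∈-sphere Γ) (distance x z))))))

cliqueExtension-grid : ∀ {V} {H : Graph V} {s p q} →
  IsCliqueExtensionOfGrid H (fromℕ s) (fromℕ p) (fromℕ q) → H ≅ cliqueExtension s (grid p q)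
cliqueExtension-grid (_ , _ , _ , s≡ , p≡ , q≡ , iso)
  with fromℕ-injective s≡ | fromℕ-injective p≡ | fromℕ-injective q≡
... | refl | refl | refl = iso

theorem26 : {n : ℕ} (Γ : FiniteGraph n)
    (D : ℕ) (b : ℤ) .{{_ : ℤ.NonZero (b ℤ.- 1ℤ)}} (α β : ℚ) .{{_ : ℚ.NonZero α}}
    (classical : HasClassicalParameters Γ D b α β)
    (𝒞 : Pred (Subset n) 0ℓ) →
    ℤ.+ 2 ℤ.≤ b →
    α ℚ.≤ fromℤ b - 1ℚ →
    1ℚ ℚ.≤ α →
    3 ℕ.≤ D →
    IsGeometric Γ (HasClassicalParameters.valency classical) 𝒞 →
    let r = [ b , D ] in
    (∀ x → IsCliqueExtensionOfGrid (induced Γ (Sphere Γ 1 x)) α (β ÷ α) r) →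
    α * r ℚ.< β →
    (∀ M → IsAssembly Γ 𝒞 M → ∀ x i → i ℕ.≤ D → DistanceToSet Γ x M i →
    fromℕ ∣ M ∩ Sphere Γ i x ∣ ≡ 1ℚ + α * [ b , i ])
    ×
    (∀ x y j → 1 ℕ.≤ j → j ℕ.≤ D → Distance Γ x y j →
    HasCount (λ M → IsAssembly Γ 𝒞 M × y ∈ M × DistanceToSet Γ x M (j ∸ 1)) [ b , j ])
    ×
    (∀ x y h → h ℕ.< D → Distance Γ x y h →
    IsCliqueExtensionOfGrid (induced Γ (Sphere Γ (suc h) x ∩ Sphere Γ 1 y))
    α ((β ÷ α) - [ b , h ]) (r - [ b , h ]))
theorem26 {n} Γ D _ α β classical 𝒞 (ℤ.+≤+ {n = b} 2≤b) _ 1≤α 3≤D geometric local αr<β =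
  (λ M assembly x i _ x→M → begin
    fromℕ ∣ M ∩ Sphere Γ i x ∣     ≡⟨ cong fromℕ (assembly-count G r<p cover metric assembly x→M) ⟩
    fromℕ (suc (g i ℕ.* a))        ≡⟨ 1+α[ i ]≡ ⟨
    1ℚ + α * [ ℤ.+ b , i ]         ∎) ,
  (λ { x y (suc h) _ _ x→y → subst (HasCount _) (sym (bracket (suc h)))
         (nearAssemblies G r<p cover metric (distance⇒d G metric x→y)) }) ,
  (λ x y h h<D x→y → a , p ∸ g h , r ∸ g h , α≡ ,
    trans (cong₂ _-_ p≡ (bracket h)) (sym (fromℕ-∸ (ℕ.≤-trans (g≤r (ℕ.<⇒≤ h<D)) (ℕ.<⇒≤ r<p)))) ,
    trans (cong₂ _-_ (bracket D) (bracket h)) (sym (fromℕ-∸ (g≤r (ℕ.<⇒≤ h<D)))) ,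
    far-neighbours G metric (distance⇒d G metric x→y))
  where
  open HasClassicalParameters classical
  open ≡-Reasoning
  open ℚSolver.+-*-Solver using (solve; _:=_; _:+_; _:*_; _:-_)
  -- The diameter supplies a vertex, and the local graph there shows that α and β / α are natural
  -- numbers.
  someLocal : IsCliqueExtensionOfGrid _ α (β ÷ α) [ ℤ.+ b , D ]
  someLocal = local (proj₁ (proj₂ diameter))
  a p : ℕ
  a = proj₁ someLocal
  p = proj₁ (proj₂ someLocal)
  α≡ : α ≡ fromℕ a
  α≡ = proj₁ (proj₂ (proj₂ (proj₂ someLocal)))
  p≡ : β ÷ α ≡ fromℕ p
  p≡ = proj₁ (proj₂ (proj₂ (proj₂ (proj₂ someLocal))))
  g : ℕ → ℕ
  g = gauss b
  r : ℕ
  r = g D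
  bracket : ∀ j → [ ℤ.+ b , j ] ≡ fromℕ (g j)
  bracket = bracket≡gauss b
  g≤r : ∀ {i} → i ℕ.≤ D → g i ℕ.≤ r
  g≤r = gauss-mono-≤ b
  β≡ : β ≡ fromℕ p * fromℕ a
  β≡ = begin
    β                    ≡⟨ ℚ.*-identityʳ β ⟨
    β * 1ℚ               ≡⟨ cong (β *_) (ℚ.*-inverseˡ α) ⟨
    β * (ℚ.1/ α * α)     ≡⟨ ℚ.*-assoc β (ℚ.1/ α) α ⟨
    β ÷ α * α            ≡⟨ cong₂ _*_ p≡ α≡ ⟩
    fromℕ p * fromℕ a    ∎
  0<a : 0 ℕ.< a
  0<a = fromℕ-cancel-< {0} (ℚ.<-≤-trans (ℚ.positive⁻¹ 1ℚ) (subst (1ℚ ℚ.≤_) α≡ 1≤α))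
  r<p : r ℕ.< p
  r<p = ℕ.*-cancelʳ-< a r p (fromℕ-cancel-< (subst₂ ℚ._<_
    (trans (cong₂ _*_ α≡ (bracket D)) (trans (ℚ.*-comm (fromℕ a) (fromℕ r)) (sym (fromℕ-* r a))))
    (trans β≡ (sym (fromℕ-* p a))) αr<β))
  1<r : 1 ℕ.< r
  -- The bound comes from r ≥ [2] = 1 + b.
  1<r = ℕ.<-≤-trans (ℕ.s<s (ℕ.≤-trans (ℕ.<-trans ℕ.z<s 2≤b) (ℕ.≤-reflexive (sym (ℕ.*-identityʳ b)))))
    (ℕ.≤-trans (ℕ.s≤s (ℕ.*-monoʳ-≤ b (ℕ.s≤s ℕ.z≤n))) (g≤r {2} (ℕ.≤-trans (ℕ.n≤1+n 2) 3≤D)))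
  1+α[_]≡ : ∀ i → 1ℚ + α * [ ℤ.+ b , i ] ≡ fromℕ (suc (g i ℕ.* a))
  1+α[ i ]≡ = begin
    1ℚ + α * [ ℤ.+ b , i ]      ≡⟨ cong (1ℚ +_) (trans (cong₂ _*_ α≡ (bracket i)) (ℚ.*-comm (fromℕ a) (fromℕ (g i)))) ⟩
    1ℚ + fromℕ (g i) * fromℕ a  ≡⟨ cong (1ℚ +_) (fromℕ-* (g i) a) ⟨
    1ℚ + fromℕ (g i ℕ.* a)      ≡⟨ fromℕ-+ 1 (g i ℕ.* a) ⟨
    fromℕ (suc (g i ℕ.* a))     ∎
  b≡ : ∀ {i} → i ℕ.≤ D → intersection-b i ≡ (p ∸ g i) ℕ.* ((r ∸ g i) ℕ.* a)
  b≡ {i} i≤D = fromℕ-injective (begin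
    fromℕ (intersection-b i)
      ≡⟨ b-formula i≤D ⟩
    ([ ℤ.+ b , D ] - [ ℤ.+ b , i ]) * (β - α * [ ℤ.+ b , i ])
      ≡⟨ cong₂ _*_ (cong₂ _-_ (bracket D) (bracket i)) (cong₂ _-_ β≡ (cong₂ _*_ α≡ (bracket i))) ⟩
    (fromℕ r - fromℕ (g i)) * (fromℕ p * fromℕ a - fromℕ a * fromℕ (g i))
      ≡⟨ solve 4 (λ r g p a → (r :- g) :* (p :* a :- a :* g) := (p :- g) :* ((r :- g) :* a)) refl
           (fromℕ r) (fromℕ (g i)) (fromℕ p) (fromℕ a) ⟩
    (fromℕ p - fromℕ (g i)) * ((fromℕ r - fromℕ (g i)) * fromℕ a)
      -- Both truncated subtractions are exact, because [i] ≤ r < p.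
      ≡⟨ cong₂ (λ s t → s * (t * fromℕ a))
           (fromℕ-∸ (ℕ.≤-trans (g≤r i≤D) (ℕ.<⇒≤ r<p))) (fromℕ-∸ (g≤r i≤D)) ⟨
    fromℕ (p ∸ g i) * (fromℕ (r ∸ g i) * fromℕ a)
      ≡⟨ trans (fromℕ-* (p ∸ g i) ((r ∸ g i) ℕ.* a)) (cong (fromℕ (p ∸ g i) *_) (fromℕ-* (r ∸ g i) a)) ⟨
    fromℕ ((p ∸ g i) ℕ.* ((r ∸ g i) ℕ.* a)) ∎)
  c≡ : ∀ {i} → suc i ℕ.≤ D → intersection-c (suc i) ≡ g (suc i) ℕ.* suc (g i ℕ.* a)
  c≡ {i} i<D = fromℕ-injective (begin
    fromℕ (intersection-c (suc i))                       ≡⟨ c-formula i<D ⟩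
    [ ℤ.+ b , suc i ] * (1ℚ + α * [ ℤ.+ b , i ])         ≡⟨ cong₂ _*_ (bracket (suc i)) 1+α[ i ]≡ ⟩
    fromℕ (g (suc i)) * fromℕ (suc (g i ℕ.* a))          ≡⟨ fromℕ-* (g (suc i)) (suc (g i ℕ.* a)) ⟨
    fromℕ (g (suc i) ℕ.* suc (g i ℕ.* a))                ∎)
  valency≡ : valency ≡ r ℕ.* (p ℕ.* a)
  valency≡ = begin
    intersection-b 0      ≡⟨ b≡ ℕ.z≤n ⟩
    p ℕ.* (r ℕ.* a)       ≡⟨ ℕ.*-assoc p r a ⟨
    p ℕ.* r ℕ.* a         ≡⟨ cong (ℕ._* a) (ℕ.*-comm p r) ⟩
    r ℕ.* p ℕ.* a         ≡⟨ ℕ.*-assoc r p a ⟩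
    r ℕ.* (p ℕ.* a)       ∎
  G : LocalGrid Γ a p r
  G = localGrid (λ x → cliqueExtension-grid (subst₂ (IsCliqueExtensionOfGrid _ (fromℕ a)) p≡ (bracket D)
        (subst (λ s → IsCliqueExtensionOfGrid _ s (β ÷ α) [ ℤ.+ b , D ]) α≡ (local x))))
      0<a (ℕ.<-trans 1<r r<p) 1<r (ℕ.<⇒≢ r<p ∘ sym)
  metric : GridMetric Γ a p r g
  metric = gridMetric Γ refl distance-regular diameter b≡ c≡
  cover : CliqueCover Γ (suc (p ℕ.* a)) 𝒞
  cover = delsarteCover G valency≡ geometric
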